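{- Let $n\ge 4$. Up to isomorphism, there are exactly $\frac{n^2-9n+22}{2}$ simplicial complexes with $n$ vertices in $\mathrm{mGU}(2)$, and the complexes $\mathcal{J}(i,j,n)$ with $(i,j)\in Q_n$ form a set of pairwise nonisomorphic representatives of these isomorphism classes.
   Context: A simplicial complex is a pair $(V,H)$ with $V$ finite nonempty, $H\subseteq 2^V$ containing all singletons and closed under subsets; its dimension is $\max\{|X|:X\in H\}-1$. $P_k(V)$, $P_{\le k}(V)$ denote subsets with exactly, at most $k$ elements. $\mathrm{Pav}(d)$ is the class of complexes of dimension $d$ with $P_{\le d}(V)\subseteq H$. For $(V,H)\in\mathrm{Pav}(d)$, $T(H)=\{T\subseteq V\mid X\cup\{p\}\in H \text{ for all } X\in H\cap P_{\le d}(V),\ X\subseteq T,\ p\in V\setminus T\}$, and $J(T(H))$ is the set of all sets $\{x_1,\dots,x_k\}$ for which there is a chain $T_0\subset\cdots\subset T_k$ in $T(H)$ with $x_i\in T_i\setminus T_{i-1}$. $(V,H)\in\mathrm{Pav}(d)$ goes up if $\dim(V,J(T(H)))>d$; $\mathrm{GU}(d)$ and $\mathrm{NGU}(d)$ are the classes of complexes in $\mathrm{Pav}(d)$ which go up, resp. do not go up. $\mathrm{mGU}(d)$ is the class of $(V,H)\in\mathrm{GU}(d)$ such that $(V,H')\in\mathrm{NGU}(d)$ whenever $H\supsetneq H'\supsetneq P_{\le d}(V)$. Let $V_n=\{1,\dots,n\}$. For $2\le i<j<n$, $\mathcal{J}(i,j,n)=(V_n,J(i,j,n))$ with $J(i,j,n)=P_{\le2}(V_n)\cup\{\{a,a',b\}\mid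 1\le a<a'\le i<b\le j\}\cup\{\{b,b',c\}\mid 1\le b<b'\le j<c\le n\}$. $Q_n=\{(i,j)\in\mathbb{N}^2\mid 2\le i<j-1<n-2\}\cup\{(2,3)\}$. Two complexes are isomorphic if some bijection between vertex sets maps faces onto faces. -}

module Defs where

open import Data.Nat using (ℕ; zero; suc; _≤_; _<_; _∸_; _≤?_; _<?_)
open import Data.Bool using (Bool; true; false)
import Data.Bool as B
open import Data.Fin using (Fin; zero; suc; toℕ; inject₁)
open import Data.Fin.Subset using (Subset; _∈_; _∉_; _⊆_; _⊂_; _∪_; ⁅_⁆; ∣_∣)
open import Data.Fin.Properties using (any?)
open import Data.Fin.Permutation using (Permutation′; _⟨$⟩ˡ_)
open import Data.Vec using (tabulate; lookup)
open import Data.Vec.Properties using (≡-dec)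
open import Data.Product using (Σ; ∃; _×_; _,_)
open import Data.Sum using (_⊎_)
open import Relation.Nullary using (¬_; Dec)
open import Relation.Nullary.Decidable using (⌊_⌋; _×-dec_; _⊎-dec_)
open import Relation.Binary.PropositionalEquality using (_≡_)
open import Function.Bundles using (_⇔_)

-- A family of subsets of the vertex set V = Fin n (vertex k+1 of the paper
-- is Fin-index k).  A family is a finite object: a Boolean predicate.
Family : ℕ → Set
Family n = Subset n → Bool

module _ {n : ℕ} where

  IsComplex : Family n → Set
  IsComplex H = (∀ p → H ⁅ p ⁆ ≡ true)
              × (∀ X Y → Y ⊆ X → H X ≡ true → H Y ≡ true)

  HasDim : Family n → ℕ → Set
  HasDim H d = (∀ X → H X ≡ true → ∣ X ∣ ≤ suc d)
             × (∃ λ X → H X ≡ true × ∣ X ∣ ≡ suc d)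

  ContainsPle : ℕ → Family n → Set
  ContainsPle d H = ∀ X → ∣ X ∣ ≤ d → H X ≡ true

  Pav : ℕ → Family n → Set
  Pav d H = IsComplex H × HasDim H d × ContainsPle d H

  InT : ℕ → Family n → Subset n → Set
  InT d H T = ∀ X → H X ≡ true → ∣ X ∣ ≤ d → X ⊆ T →
              ∀ p → p ∉ T → H (X ∪ ⁅ p ⁆) ≡ true

  -- X ∈ J(T(H)): X = {x_1,…,x_k} for a chain T_0 ⊂ ⋯ ⊂ T_k in T(H)
  -- with x_i ∈ T_i ∖ T_{i-1}.  (Ts t = T_t, xs i = x_{i+1}.)
  InJT : ℕ → Family n → Subset n → Set
  InJT d H X =
    Σ ℕ λ k → Σ (Fin (suc k) → Subset n) λ Ts → Σ (Fin k → Fin n) λ xs →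
      (∀ t → InT d H (Ts t))
    × (∀ i → Ts (inject₁ i) ⊂ Ts (suc i))
    × (∀ i → xs i ∈ Ts (suc i) × xs i ∉ Ts (inject₁ i))
    × (∀ y → (y ∈ X) ⇔ (∃ λ i → xs i ≡ y))

  -- (V,H) goes up: dim (V, J(T(H))) > d, i.e. some member has ≥ d+2 elements
  GoesUp : ℕ → Family n → Set
  GoesUp d H = ∃ λ X → InJT d H X × suc (suc d) ≤ ∣ X ∣

  GU : ℕ → Family n → Set
  GU d H = Pav d H × GoesUp d H

  NGU : ℕ → Family n → Set
  NGU d H = Pav d H × ¬ GoesUp d H

  _⊋F_ : Family n → Family n → Set
  H ⊋F H' = (∀ X → H' X ≡ true → H X ≡ true) × (∃ λ X → H X ≡ true × H' X ≡ false)

  StrictlyAbovePle : ℕ → Family n → Set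
  StrictlyAbovePle d H' = ContainsPle d H' × (∃ λ X → H' X ≡ true × ¬ (∣ X ∣ ≤ d))

  mGU : ℕ → Family n → Set
  mGU d H = GU d H × (∀ H' → H ⊋F H' → StrictlyAbovePle d H' → NGU d H')

  image : Permutation′ n → Subset n → Subset n
  image σ X = tabulate (λ y → lookup X (σ ⟨$⟩ˡ y))

  Iso : Family n → Family n → Set
  Iso H H' = Σ (Permutation′ n) λ σ → ∀ X → H' (image σ X) ≡ H X

-- the paper's label (1-based) of a vertex
lbl : ∀ {n} → Fin n → ℕ
lbl k = suc (toℕ k)

Type1 : ∀ {n} → ℕ → ℕ → Subset n → Set
Type1 {n} i j X = ∃ λ (a : Fin n) → ∃ λ (a' : Fin n) → ∃ λ (b : Fin n) →
  (lbl a < lbl a' × lbl a' ≤ i × i < lbl b × lbl b ≤ j)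
  × X ≡ ((⁅ a ⁆ ∪ ⁅ a' ⁆) ∪ ⁅ b ⁆)

-- the membership predicate of J(i,j,n) (b ≤ n is automatic for labels)
JSet : (n : ℕ) → ℕ → ℕ → Subset n → Set
JSet n i j X = (∣ X ∣ ≤ 2) ⊎ Type1 i j X ⊎ Type1 j n X

private
  type1? : ∀ {n} i j (X : Subset n) → Dec (Type1 i j X)
  type1? i j X = any? λ a → any? λ a' → any? λ b →
    ((lbl a <? lbl a') ×-dec (lbl a' ≤? i) ×-dec (i <? lbl b) ×-dec (lbl b ≤? j))
    ×-dec ≡-dec B._≟_ X ((⁅ a ⁆ ∪ ⁅ a' ⁆) ∪ ⁅ b ⁆)

  jset? : ∀ n i j (X : Subset n) → Dec (JSet n i j X)
  jset? n i j X = (∣ X ∣ ≤? 2) ⊎-dec type1? i j X ⊎-dec type1? j n X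

J : (i j n : ℕ) → Family n
J i j n X = ⌊ jset? n i j X ⌋

InQ : ℕ → ℕ → ℕ → Set
InQ n i j = (2 ≤ i × i < j ∸ 1 × j ∸ 1 < n ∸ 2) ⊎ (i ≡ 2 × j ≡ 3)

Q : ℕ → Set
Q n = Σ ℕ λ i → Σ ℕ λ j → InQ n i j

JQ : ∀ n → Q n → Family n
JQ n (i , j , _) = J i j n

fstQ : ∀ n → Q n → ℕ
fstQ _ (i , _ , _) = i

sndQ : ∀ n → Q n → ℕ
sndQ _ (_ , j , _) = j

{-# OPTIONS --safe #-}
module Submission where

-- For d = 2 a set T lies in T(H) iff every triple meeting T in exactly two
-- points is a face, and H goes up iff T(H) contains A ⊂ B with
-- 2 ≤ |A| < |B| < n.  So the minimal complexes that go up are the minimal ones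
-- among J(A,B), the least family with A and B in its lattice, which is a copy of
-- J(|A|,|B|,n).  If |A| + 2 ≤ |B| ≤ n - 2, then A and B are the only members of
-- T(J(A,B)) with at least two and fewer than n points: this gives minimality and
-- recovers (|A|,|B|) from the isomorphism type.  In the remaining cases T(H)
-- contains further members: V ∖ B = {c} puts A ∪ {c} in T(H), and B ∖ A = {b}
-- puts {a,b} in T(H) for all a ∈ A; these lead to a pair of sizes (2,3) or of the
-- previous kind.  For sizes (2,3) the family consists of the triples
-- meeting B in at least two points, and is minimal by inspection.

open import Defs
import Algebra.Properties.CommutativeMonoid.Sum as Sum
open import Data.Bool using (Bool; true; false; if_then_else_)
open import Data.Bool.Properties using (T-≡; ¬-not; not-¬)
open import Data.Empty using (⊥-elim)
open import Data.Fin using (Fin; zero; suc; toℕ; fromℕ<; inject₁; punchIn)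
open import Data.Fin.Permutation using (Permutation′; id; _⟨$⟩ʳ_; _⟨$⟩ˡ_; inverseˡ; inverseʳ; flip; insert; insert-punchIn)
open import Data.Fin.Properties using (_≟_; any?; toℕ<n; toℕ-fromℕ<; toℕ-injective; +↔⊎)
open import Data.Fin.Subset using (Subset; _∈_; _∉_; _⊆_; _⊂_; _∪_; ⁅_⁆; ∣_∣; ⊥; ⊤)
open import Data.Fin.Subset.Properties
open import Data.Nat using (ℕ; zero; suc; _≤_; _<_; _+_; _*_; _^_; _∸_; _<ᵇ_; z≤n; s≤s; _≤?_)
open import Data.Nat.Properties using (≤-trans; ≤-reflexive; ≤-refl; ≤-pred; ≰⇒>; <⇒≱; <⇒≤; <-irrefl; <-trans; ≤-<-trans; <-≤-trans; ≤-antisym; m≤n⇒m<n∨m≡n; +-mono-≤; +-monoʳ-≤; +-suc; +-comm; n≤1+n; <-cmp; ≤-irrelevant; +-0-commutativeMonoid; m+[n∸m]≡n; <⇒<ᵇ; <ᵇ⇒<; ≮⇒≥; +-cancelˡ-≡; ≡-irrelevant)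
open import Data.Nat.Tactic.RingSolver using (solve-∀)
open import Data.Product using (Σ; ∃; _×_; _,_; proj₁; proj₂)
open import Data.Sum using (_⊎_; inj₁; inj₂; map)
open import Data.Sum.Function.Propositional using (_⊎-↔_)
open import Data.Vec using ([]; _∷_; here; lookup; tabulate)
open import Data.Vec.Properties using (lookup∘tabulate; []=⇒lookup; lookup⇒[]=; tabulate-cong)
open import Function.Base using (_∘_)
open import Function.Bundles using (_↔_; mk⇔; mk↔ₛ′; Equivalence)
open import Function.Properties.Inverse using (↔-refl; ↔-trans)
open import Relation.Binary.Definitions using (tri<; tri≈; tri>)
open import Relation.Binary.PropositionalEquality using (_≡_; _≢_; refl; sym; trans; cong; cong₂; subst; subst₂; ≢-sym; module ≡-Reasoning)
open import Relation.Nullary using (¬_; Dec; yes; no; contradiction)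
open import Relation.Nullary.Decidable using (isYes; _×-dec_; ¬?)

open Sum +-0-commutativeMonoid using (sum; sum-permute; sum-cong-≋)

private
  variable
    n : ℕ
    w x y z : Fin n
    A B S T U X : Subset n
    H : Family n

-- Cardinalities of subsets

∣p∪q∣≤∣p∣+∣q∣ : (p q : Subset n) → ∣ p ∪ q ∣ ≤ ∣ p ∣ + ∣ q ∣
∣p∪q∣≤∣p∣+∣q∣ [] [] = z≤n
∣p∪q∣≤∣p∣+∣q∣ (true ∷ p) (true ∷ q) = s≤s (≤-trans (∣p∪q∣≤∣p∣+∣q∣ p q) (+-monoʳ-≤ ∣ p ∣ (n≤1+n ∣ q ∣)))
∣p∪q∣≤∣p∣+∣q∣ (true ∷ p) (false ∷ q) = s≤s (∣p∪q∣≤∣p∣+∣q∣ p q)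
∣p∪q∣≤∣p∣+∣q∣ (false ∷ p) (true ∷ q) =
  ≤-trans (s≤s (∣p∪q∣≤∣p∣+∣q∣ p q)) (≤-reflexive (sym (+-suc ∣ p ∣ ∣ q ∣)))
∣p∪q∣≤∣p∣+∣q∣ (false ∷ p) (false ∷ q) = ∣p∪q∣≤∣p∣+∣q∣ p q

∣p∪⁅x⁆∣≤ : ∀ {k} (p : Subset n) (x : Fin n) → ∣ p ∣ ≤ k → ∣ p ∪ ⁅ x ⁆ ∣ ≤ suc k
∣p∪⁅x⁆∣≤ {k = k} p x p≤k = ≤-trans (∣p∪q∣≤∣p∣+∣q∣ p ⁅ x ⁆)
  (≤-trans (+-mono-≤ p≤k (≤-reflexive (∣⁅x⁆∣≡1 x))) (≤-reflexive (+-comm k 1)))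

∈∪ˡ : x ∈ S → x ∈ S ∪ T
∈∪ˡ x∈S = x∈p∪q⁺ (inj₁ x∈S)

∈∪ʳ : x ∈ S ∪ ⁅ x ⁆
∈∪ʳ {x = x} = x∈p∪q⁺ (inj₂ (x∈⁅x⁆ x))

∈∪⁅⁆⁻ : x ∈ S ∪ ⁅ y ⁆ → x ∈ S ⊎ x ≡ y
∈∪⁅⁆⁻ {S = S} {y = y} x∈ with x∈p∪q⁻ S ⁅ y ⁆ x∈
... | inj₁ x∈S = inj₁ x∈S
... | inj₂ x∈y = inj₂ (x∈⁅y⁆⇒x≡y y x∈y)

∪⁅⁆⊆ : S ⊆ U → x ∈ U → S ∪ ⁅ x ⁆ ⊆ U
∪⁅⁆⊆ S⊆U x∈U w∈ with ∈∪⁅⁆⁻ w∈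
... | inj₁ w∈S = S⊆U w∈S
... | inj₂ refl = x∈U

1+∣p∣≤ : S ⊆ U → x ∈ U → x ∉ S → 1 + ∣ S ∣ ≤ ∣ U ∣
1+∣p∣≤ S⊆U x∈U x∉S = p⊂q⇒∣p∣<∣q∣ (S⊆U , _ , x∈U , x∉S)

∣p∪⁅x⁆∣≡ : x ∉ S → ∣ S ∪ ⁅ x ⁆ ∣ ≡ suc ∣ S ∣
∣p∪⁅x⁆∣≡ {x = x} {S = S} x∉S = ≤-antisym (∣p∪⁅x⁆∣≤ S x ≤-refl) (1+∣p∣≤ ∈∪ˡ ∈∪ʳ x∉S)

2+∣p∣≤ : S ⊆ U → x ∈ U → x ∉ S → y ∈ U → y ∉ S → x ≢ y → 2 + ∣ S ∣ ≤ ∣ U ∣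
2+∣p∣≤ {S = S} {U = U} {x = x} {y = y} S⊆U x∈U x∉S y∈U y∉S x≢y =
  subst (λ k → suc k ≤ ∣ U ∣) (∣p∪⁅x⁆∣≡ x∉S) (1+∣p∣≤ (∪⁅⁆⊆ S⊆U x∈U) y∈U y∉)
  where
  y∉ : y ∉ S ∪ ⁅ x ⁆
  y∉ y∈ with ∈∪⁅⁆⁻ y∈
  ... | inj₁ y∈S = y∉S y∈S
  ... | inj₂ y≡x = x≢y (sym y≡x)

∣⁅x⁆∪⁅y⁆∣≡2 : {x y : Fin n} → x ≢ y → ∣ ⁅ x ⁆ ∪ ⁅ y ⁆ ∣ ≡ 2
∣⁅x⁆∪⁅y⁆∣≡2 {x = x} {y} x≢y =
  trans (∣p∪⁅x⁆∣≡ (x≢y⇒x∉⁅y⁆ (≢-sym x≢y))) (cong suc (∣⁅x⁆∣≡1 x))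

∃∈∖ : (S U : Subset n) → ∣ S ∣ < ∣ U ∣ → ∃ λ x → x ∈ U × x ∉ S
∃∈∖ S U S<U with any? (λ x → (x ∈? U) ×-dec ¬? (x ∈? S))
... | yes e = e
... | no ¬e = contradiction (p⊆q⇒∣p∣≤∣q∣ U⊆S) (<⇒≱ S<U)
  where
  U⊆S : U ⊆ S
  U⊆S {x} x∈U with x ∈? S
  ... | yes x∈S = x∈S
  ... | no x∉S = ⊥-elim (¬e (x , x∈U , x∉S))

∃∈ : (U : Subset n) → 0 < ∣ U ∣ → ∃ λ x → x ∈ U
∃∈ {n} U 0<U with ∃∈∖ ⊥ U (subst (_< ∣ U ∣) (sym (∣⊥∣≡0 n)) 0<U)
... | x , x∈U , _ = x , x∈U

∃∈≢ : (U : Subset n) (x : Fin n) → 2 ≤ ∣ U ∣ → ∃ λ y → y ∈ U × y ≢ x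
∃∈≢ U x 2≤U with ∃∈∖ ⁅ x ⁆ U (subst (_< ∣ U ∣) (sym (∣⁅x⁆∣≡1 x)) 2≤U)
... | y , y∈U , y∉x = y , y∈U , x∉⁅y⁆⇒x≢y y∉x

∃∉ : (S : Subset n) → ∣ S ∣ < n → ∃ λ x → x ∉ S
∃∉ {n} S S<n with ∃∈∖ S ⊤ (subst (∣ S ∣ <_) (sym (∣⊤∣≡n n)) S<n)
... | x , _ , x∉S = x , x∉S

∃∈∖≢ : (S U : Subset n) (x : Fin n) → 2 + ∣ S ∣ ≤ ∣ U ∣ → ∃ λ y → y ∈ U × y ∉ S × x ≢ y
∃∈∖≢ S U x S+2≤U with ∃∈∖ (S ∪ ⁅ x ⁆) U (≤-<-trans (∣p∪⁅x⁆∣≤ S x ≤-refl) S+2≤U)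
... | y , y∈U , y∉ = y , y∈U , (λ y∈S → y∉ (∈∪ˡ y∈S)) , λ { refl → y∉ ∈∪ʳ }

∖-unique : S ⊆ U → ∣ U ∣ ≡ suc ∣ S ∣ → x ∈ U → x ∉ S → y ∈ U → y ∉ S → x ≡ y
∖-unique {x = x} {y = y} S⊆U ∣U∣≡ x∈U x∉S y∈U y∉S with x ≟ y
... | yes x≡y = x≡y
... | no x≢y = contradiction (2+∣p∣≤ S⊆U x∈U x∉S y∈U y∉S x≢y) (<⇒≱ (s≤s (≤-reflexive ∣U∣≡)))

⊆∧∣≥∣⇒≡ : S ⊆ U → ∣ U ∣ ≤ ∣ S ∣ → S ≡ U
⊆∧∣≥∣⇒≡ {S = S} {U = U} S⊆U U≤S = ⊆-antisym S⊆U U⊆S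
  where
  U⊆S : U ⊆ S
  U⊆S {x} x∈U with x ∈? S
  ... | yes x∈S = x∈S
  ... | no x∉S = contradiction U≤S (<⇒≱ (1+∣p∣≤ S⊆U x∈U x∉S))

-- Triples of vertices.

tri : Fin n → Fin n → Fin n → Subset n
tri x y z = (⁅ x ⁆ ∪ ⁅ y ⁆) ∪ ⁅ z ⁆

∈tri⁻ : w ∈ tri x y z → w ≡ x ⊎ w ≡ y ⊎ w ≡ z
∈tri⁻ {x = x} w∈ with ∈∪⁅⁆⁻ w∈
... | inj₂ w≡z = inj₂ (inj₂ w≡z)
... | inj₁ w∈′ with ∈∪⁅⁆⁻ w∈′
... | inj₁ w∈x = inj₁ (x∈⁅y⁆⇒x≡y x w∈x)
... | inj₂ w≡y = inj₂ (inj₁ w≡y)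

∈tri₁ : x ∈ tri x y z
∈tri₁ {x = x} = ∈∪ˡ (∈∪ˡ (x∈⁅x⁆ x))

∈tri₂ : y ∈ tri x y z
∈tri₂ = ∈∪ˡ ∈∪ʳ

∈tri₃ : z ∈ tri x y z
∈tri₃ = ∈∪ʳ

tri⊆ : x ∈ U → y ∈ U → z ∈ U → tri x y z ⊆ U
tri⊆ {x = x} x∈ y∈ z∈ w∈ with ∈tri⁻ w∈
... | inj₁ refl = x∈
... | inj₂ (inj₁ refl) = y∈
... | inj₂ (inj₂ refl) = z∈

tri-swap₁₂ : (x y z : Fin n) → tri x y z ≡ tri y x z
tri-swap₁₂ x y z = cong (_∪ ⁅ z ⁆) (∪-comm ⁅ x ⁆ ⁅ y ⁆)

tri-swap₂₃ : (x y z : Fin n) → tri x y z ≡ tri x z y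
tri-swap₂₃ x y z = ⊆-antisym (tri⊆ ∈tri₁ ∈tri₃ ∈tri₂) (tri⊆ ∈tri₁ ∈tri₃ ∈tri₂)

tri-rotate : (x y z : Fin n) → tri x y z ≡ tri y z x
tri-rotate x y z = trans (tri-swap₁₂ x y z) (tri-swap₂₃ y x z)

Distinct : Fin n → Fin n → Fin n → Set
Distinct x y z = x ≢ y × x ≢ z × y ≢ z

∣tri∣≡3 : {x y z : Fin n} → Distinct x y z → ∣ tri x y z ∣ ≡ 3
∣tri∣≡3 {x = x} {y} {z} (x≢y , x≢z , y≢z) = trans (∣p∪⁅x⁆∣≡ z∉) (cong suc (∣⁅x⁆∪⁅y⁆∣≡2 x≢y))
  where
  z∉ : z ∉ ⁅ x ⁆ ∪ ⁅ y ⁆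
  z∉ z∈ with ∈∪⁅⁆⁻ z∈
  ... | inj₁ z∈x = x≢z (sym (x∈⁅y⁆⇒x≡y x z∈x))
  ... | inj₂ z≡y = y≢z (sym z≡y)

∈∧∉⇒≢ : x ∈ S → y ∉ S → x ≢ y
∈∧∉⇒≢ x∈S y∉S refl = y∉S x∈S

∣S∣≡2⇒pair : (S : Subset n) → ∣ S ∣ ≡ 2 → ∃ λ x → ∃ λ y → x ≢ y × S ≡ ⁅ x ⁆ ∪ ⁅ y ⁆
∣S∣≡2⇒pair S ∣S∣≡2 with ∃∈ S (subst (0 <_) (sym ∣S∣≡2) (s≤s z≤n))
... | x , x∈S with ∃∈≢ S x (≤-reflexive (sym ∣S∣≡2))
... | y , y∈S , y≢x = x , y , ≢-sym y≢x ,
  sym (⊆∧∣≥∣⇒≡ (∪⁅⁆⊆ ⁅x⁆⊆S y∈S) (≤-reflexive (trans ∣S∣≡2 (sym (∣⁅x⁆∪⁅y⁆∣≡2 (≢-sym y≢x))))))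
  where
  ⁅x⁆⊆S : ⁅ x ⁆ ⊆ S
  ⁅x⁆⊆S w∈ with refl ← x∈⁅y⁆⇒x≡y x w∈ = x∈S

-- The lattice T(H) when d = 2

-- For a family containing all sets with at most two elements, only the pairs
-- in T impose a condition on T ∈ T(H).
Closed : Family n → Subset n → Set
Closed H T = ∀ {x y z} → x ≢ y → x ∈ T → y ∈ T → z ∉ T → H (tri x y z) ≡ true

InT⇒Closed : ContainsPle 2 H → InT 2 H T → Closed H T
InT⇒Closed {H = H} {T = T} ple inT {x} {y} {z} x≢y x∈T y∈T z∉T =
  inT (⁅ x ⁆ ∪ ⁅ y ⁆) (ple _ xy≤2) xy≤2 (∪⁅⁆⊆ ⁅x⁆⊆T y∈T) z z∉T
  where
  xy≤2 = ≤-reflexive (∣⁅x⁆∪⁅y⁆∣≡2 x≢y)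
  ⁅x⁆⊆T : ⁅ x ⁆ ⊆ T
  ⁅x⁆⊆T w∈ with refl ← x∈⁅y⁆⇒x≡y x w∈ = x∈T

Closed⇒InT : ContainsPle 2 H → Closed H T → InT 2 H T
Closed⇒InT {H = H} {T = T} ple cl X _ X≤2 X⊆T p p∉T with m≤n⇒m<n∨m≡n X≤2
... | inj₁ X<2 = ple _ (∣p∪⁅x⁆∣≤ X p (≤-pred X<2))
... | inj₂ X≡2 with ∣S∣≡2⇒pair X X≡2
... | x , y , x≢y , refl = cl x≢y (X⊆T (∈∪ˡ (x∈⁅x⁆ x))) (X⊆T ∈∪ʳ) p∉T

Splits : Subset n → Fin n → Fin n → Fin n → Set
Splits A x y z = (x ∈ A × y ∈ A × z ∉ A) ⊎ (y ∈ A × z ∈ A × x ∉ A) ⊎ (z ∈ A × x ∈ A × y ∉ A)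

Closed⇒Splits : Closed H T → Distinct x y z → Splits T x y z → H (tri x y z) ≡ true
Closed⇒Splits cl (x≢y , _ , _) (inj₁ (x∈ , y∈ , z∉)) = cl x≢y x∈ y∈ z∉
Closed⇒Splits {H = H} {x = x} {y} {z} cl (_ , _ , y≢z) (inj₂ (inj₁ (y∈ , z∈ , x∉))) =
  trans (cong H (tri-rotate x y z)) (cl y≢z y∈ z∈ x∉)
Closed⇒Splits {H = H} {x = x} {y} {z} cl (_ , x≢z , _) (inj₂ (inj₂ (z∈ , x∈ , y∉))) =
  trans (cong H (sym (tri-rotate z x y))) (cl (≢-sym x≢z) z∈ x∈ y∉)

-- A chain in T(H) can always run through the empty set, one point and all of V. `A` and `B` are two
-- further members, and the bounds on their sizes keep them apart from the trivial ones.
record ClosedPair (H : Family n) (A B : Subset n) : Set where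
  field
    2≤∣A∣    : 2 ≤ ∣ A ∣
    A⊆B      : A ⊆ B
    ∣A∣<∣B∣  : ∣ A ∣ < ∣ B ∣
    ∣B∣<n    : ∣ B ∣ < n
    A-closed : Closed H A
    B-closed : Closed H B

∣range∣≤ : ∀ {k} (xs : Fin k → Fin n) (X : Subset n) → (∀ y → y ∈ X → ∃ λ i → xs i ≡ y) → ∣ X ∣ ≤ k
∣range∣≤ {n = n} {k} xs X cover = ≤-trans (p⊆q⇒∣p∣≤∣q∣ λ {y} y∈X → range∋ xs (cover y y∈X)) (∣range∣ k xs)
  where
  range : ∀ {k} → (Fin k → Fin n) → Subset n
  range {zero} _ = ⊥
  range {suc k} xs = range (xs ∘ suc) ∪ ⁅ xs zero ⁆
  ∣range∣ : ∀ k (xs : Fin k → Fin n) → ∣ range xs ∣ ≤ k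
  ∣range∣ zero xs = ≤-reflexive (∣⊥∣≡0 n)
  ∣range∣ (suc k) xs = ∣p∪⁅x⁆∣≤ (range (xs ∘ suc)) (xs zero) (∣range∣ k (xs ∘ suc))
  range∋ : ∀ {k} (xs : Fin k → Fin n) {y} → (∃ λ i → xs i ≡ y) → y ∈ range xs
  range∋ xs (zero , refl) = ∈∪ʳ
  range∋ xs (suc i , eq) = ∈∪ˡ (range∋ (xs ∘ suc) (i , eq))

-- A set of at least four elements needs a chain with at least five members. Strictness gives the
-- member of index 2 at least two points, and the one of index 3 fewer than n because index 4 still
-- lies above it.
GoesUp⇒ClosedPair : ContainsPle 2 H → GoesUp 2 H → ∃ λ A → ∃ λ B → ClosedPair H A B
GoesUp⇒ClosedPair ple (X , (k , Ts , xs , inT , mono , _ , X⇔) , 4≤X)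
  with ≤-trans 4≤X (∣range∣≤ xs X λ y → Equivalence.to (X⇔ y))
... | s≤s (s≤s (s≤s (s≤s _))) = Ts (suc (suc zero)) , Ts (suc (suc (suc zero))) , record
  { 2≤∣A∣ = ≤-trans (s≤s (≤-trans (s≤s z≤n) (p⊂q⇒∣p∣<∣q∣ (mono zero)))) (p⊂q⇒∣p∣<∣q∣ (mono (suc zero)))
  ; A⊆B = proj₁ (mono (suc (suc zero)))
  ; ∣A∣<∣B∣ = p⊂q⇒∣p∣<∣q∣ (mono (suc (suc zero)))
  ; ∣B∣<n = <-≤-trans (p⊂q⇒∣p∣<∣q∣ (mono (suc (suc (suc zero))))) (∣p∣≤n (Ts (suc (suc (suc (suc zero))))))
  ; A-closed = InT⇒Closed ple (inT _)
  ; B-closed = InT⇒Closed ple (inT _)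
  }

-- The chain is ∅ ⊂ {x₁} ⊂ A ⊂ B ⊂ V.
ClosedPair⇒GoesUp : {H : Family n} {A B : Subset n} → ContainsPle 2 H → ClosedPair H A B → GoesUp 2 H
ClosedPair⇒GoesUp {n = n} {H = H} {A = A} {B = B} ple pair
  with ∃∈ A (≤-trans (s≤s z≤n) 2≤∣A∣) | ∃∈∖ A B ∣A∣<∣B∣ | ∃∉ B ∣B∣<n
  where open ClosedPair pair
... | x₁ , x₁∈A | x₃ , x₃∈B , x₃∉A | x₄ , x₄∉B with ∃∈≢ A x₁ (ClosedPair.2≤∣A∣ pair)
... | x₂ , x₂∈A , x₂≢x₁ = Y , (4 , Ts , xs , inT , mono , new , λ y → mk⇔ to from) , 4≤Y
  where
  open ClosedPair pair
  Y : Subset n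
  Y = tri x₁ x₂ x₃ ∪ ⁅ x₄ ⁆
  Ts : Fin 5 → Subset n
  Ts zero = ⊥
  Ts (suc zero) = ⁅ x₁ ⁆
  Ts (suc (suc zero)) = A
  Ts (suc (suc (suc zero))) = B
  Ts (suc (suc (suc (suc zero)))) = ⊤
  xs : Fin 4 → Fin n
  xs zero = x₁
  xs (suc zero) = x₂
  xs (suc (suc zero)) = x₃
  xs (suc (suc (suc zero))) = x₄
  inT : ∀ t → InT 2 H (Ts t)
  inT zero = Closed⇒InT ple λ _ x∈ → ⊥-elim (∉⊥ x∈)
  inT (suc zero) = Closed⇒InT ple λ x≢y x∈ y∈ →
    contradiction (trans (x∈⁅y⁆⇒x≡y x₁ x∈) (sym (x∈⁅y⁆⇒x≡y x₁ y∈))) x≢y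
  inT (suc (suc zero)) = Closed⇒InT ple A-closed
  inT (suc (suc (suc zero))) = Closed⇒InT ple B-closed
  inT (suc (suc (suc (suc zero)))) = Closed⇒InT ple λ _ _ _ z∉ → ⊥-elim (z∉ ∈⊤)
  new : ∀ i → xs i ∈ Ts (suc i) × xs i ∉ Ts (inject₁ i)
  new zero = x∈⁅x⁆ x₁ , ∉⊥
  new (suc zero) = x₂∈A , x≢y⇒x∉⁅y⁆ x₂≢x₁
  new (suc (suc zero)) = x₃∈B , x₃∉A
  new (suc (suc (suc zero))) = ∈⊤ , x₄∉B
  incl : ∀ i → Ts (inject₁ i) ⊆ Ts (suc i)
  incl zero = ⊥⊆
  incl (suc zero) w∈ with refl ← x∈⁅y⁆⇒x≡y x₁ w∈ = x₁∈A
  incl (suc (suc zero)) = A⊆B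
  incl (suc (suc (suc zero))) = ⊆⊤
  mono : ∀ i → Ts (inject₁ i) ⊂ Ts (suc i)
  mono i = incl i , xs i , new i
  to : ∀ {y} → y ∈ Y → ∃ λ i → xs i ≡ y
  to y∈ with ∈∪⁅⁆⁻ y∈
  ... | inj₂ y≡x₄ = suc (suc (suc zero)) , sym y≡x₄
  ... | inj₁ y∈tri with ∈tri⁻ y∈tri
  ... | inj₁ y≡x₁ = zero , sym y≡x₁
  ... | inj₂ (inj₁ y≡x₂) = suc zero , sym y≡x₂
  ... | inj₂ (inj₂ y≡x₃) = suc (suc zero) , sym y≡x₃
  from : ∀ {y} → (∃ λ i → xs i ≡ y) → y ∈ Y
  from (zero , refl) = ∈∪ˡ ∈tri₁
  from (suc zero , refl) = ∈∪ˡ ∈tri₂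
  from (suc (suc zero) , refl) = ∈∪ˡ ∈tri₃
  from (suc (suc (suc zero)) , refl) = ∈∪ʳ
  4≤Y : 4 ≤ ∣ Y ∣
  4≤Y = ≤-reflexive (sym (trans
    (∣p∪⁅x⁆∣≡ λ x₄∈ → x₄∉B (tri⊆ (A⊆B x₁∈A) (A⊆B x₂∈A) x₃∈B x₄∈))
    (cong suc (∣tri∣≡3 (≢-sym x₂≢x₁ , ∈∧∉⇒≢ x₁∈A x₃∉A , ∈∧∉⇒≢ x₂∈A x₃∉A)))))

-- The complexes J(A,B)

-- These are the triples that membership of `A` in T(H) forces to be faces. The third point may be
-- anywhere outside `A`, whereas `Type1 i j` also bounds it by j.
SplitSet : Subset n → Subset n → Set
SplitSet A X = ∃ λ x → ∃ λ y → ∃ λ z → x ≢ y × x ∈ A × y ∈ A × z ∉ A × X ≡ tri x y z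

-- J(i,j,n) is, up to relabelling, the least family containing P≤2 in whose
-- lattice T both A and B lie, for any A ⊂ B of sizes i and j.
record IsJ (H : Family n) (A B : Subset n) : Set where
  field
    ple   : ContainsPle 2 H
    pair  : ClosedPair H A B
    sound : ∀ X → H X ≡ true → ∣ X ∣ ≤ 2 ⊎ SplitSet A X ⊎ SplitSet B X
  open ClosedPair pair public

IsJ-least : {H K : Family n} {A B : Subset n} → IsJ H A B → ContainsPle 2 K → Closed K A → Closed K B →
            ∀ X → H X ≡ true → K X ≡ true
IsJ-least isJ pleK clA clB X HX with IsJ.sound isJ X HX
... | inj₁ X≤2 = pleK X X≤2
... | inj₂ (inj₁ (x , y , z , x≢y , x∈ , y∈ , z∉ , refl)) = clA x≢y x∈ y∈ z∉
... | inj₂ (inj₂ (x , y , z , x≢y , x∈ , y∈ , z∉ , refl)) = clB x≢y x∈ y∈ z∉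

∣SplitSet∣≡3 : SplitSet A X → ∣ X ∣ ≡ 3
∣SplitSet∣≡3 (x , y , z , x≢y , x∈ , y∈ , z∉ , refl) = ∣tri∣≡3 (x≢y , ∈∧∉⇒≢ x∈ z∉ , ∈∧∉⇒≢ y∈ z∉)

∣face∣≤3 : IsJ H A B → ∀ X → H X ≡ true → ∣ X ∣ ≤ 3
∣face∣≤3 isJ X HX with IsJ.sound isJ X HX
... | inj₁ X≤2 = ≤-trans X≤2 (n≤1+n 2)
... | inj₂ (inj₁ s) = ≤-reflexive (∣SplitSet∣≡3 s)
... | inj₂ (inj₂ s) = ≤-reflexive (∣SplitSet∣≡3 s)

∃-face₃ : {H : Family n} {A B : Subset n} → IsJ H A B → ∃ λ X → H X ≡ true × ∣ X ∣ ≡ 3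
∃-face₃ {A = A} {B} isJ with ∃∈ A (≤-trans (s≤s z≤n) (IsJ.2≤∣A∣ isJ)) | ∃∉ B (IsJ.∣B∣<n isJ)
... | x , x∈A | z , z∉B with ∃∈≢ A x (IsJ.2≤∣A∣ isJ)
... | y , y∈A , y≢x = tri x y z , B-closed (≢-sym y≢x) x∈B y∈B z∉B ,
  ∣tri∣≡3 (≢-sym y≢x , ∈∧∉⇒≢ x∈B z∉B , ∈∧∉⇒≢ y∈B z∉B)
  where
  open IsJ isJ
  x∈B = A⊆B x∈A
  y∈B = A⊆B y∈A

-- Closure under subsets is automatic: a subset of a face has at most two elements or, having three,
-- is the face itself.
Pav₂ : ContainsPle 2 H → (∀ X → H X ≡ true → ∣ X ∣ ≤ 3) → (∃ λ X → H X ≡ true × ∣ X ∣ ≡ 3) → Pav 2 H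
Pav₂ {H = H} ple H≤3 top = ((λ p → ple _ (≤-trans (≤-reflexive (∣⁅x⁆∣≡1 p)) (n≤1+n 1))) , down) , (H≤3 , top) , ple
  where
  down : ∀ X Y → Y ⊆ X → H X ≡ true → H Y ≡ true
  down X Y Y⊆X HX with ∣ Y ∣ ≤? 2
  ... | yes Y≤2 = ple Y Y≤2
  ... | no Y≰2 = trans (cong H (⊆∧∣≥∣⇒≡ Y⊆X (≤-trans (H≤3 X HX) (≰⇒> Y≰2)))) HX

IsJ⇒GU : IsJ H A B → GU 2 H
IsJ⇒GU isJ = Pav₂ (IsJ.ple isJ) (∣face∣≤3 isJ) (∃-face₃ isJ) , ClosedPair⇒GoesUp (IsJ.ple isJ) (IsJ.pair isJ)

-- Closed sets of J(A,B)

two-out⇒¬SplitSet : x ∉ A → y ∉ A → ¬ SplitSet A (tri x y z)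
two-out⇒¬SplitSet {x = x} {A = A} {y = y} {z = z} x∉ y∉ (a , a′ , b , a≢a′ , a∈ , a′∈ , _ , eq) =
  a≢a′ (trans (third a∈ (subst (a ∈_) (sym eq) ∈tri₁)) (sym (third a′∈ (subst (a′ ∈_) (sym eq) ∈tri₂))))
  where
  third : ∀ {w} → w ∈ A → w ∈ tri x y z → w ≡ z
  third w∈A w∈tri with ∈tri⁻ w∈tri
  ... | inj₁ refl = ⊥-elim (x∉ w∈A)
  ... | inj₂ (inj₁ refl) = ⊥-elim (y∉ w∈A)
  ... | inj₂ (inj₂ w≡z) = w≡z

all-in⇒¬SplitSet : x ∈ A → y ∈ A → z ∈ A → ¬ SplitSet A (tri x y z)
all-in⇒¬SplitSet x∈ y∈ z∈ (a , a′ , b , _ , _ , _ , b∉ , eq) = b∉ (tri⊆ x∈ y∈ z∈ (subst (b ∈_) (sym eq) ∈tri₃))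

-- Were `z` outside `T`, closedness would make the triple a face with three elements, and by `sound`
-- such a face splits `A` or `B`. The closed sets of J(A,B) are found by absorbing points in this
-- way.
Closed-absorbs : IsJ H A B → Closed H T → x ≢ y → x ∈ T → y ∈ T →
                 ¬ SplitSet A (tri x y z) → ¬ SplitSet B (tri x y z) → z ∈ T
Closed-absorbs {T = T} {z = z} isJ cl x≢y x∈ y∈ ¬A ¬B with z ∈? T
... | yes z∈ = z∈
... | no z∉ with IsJ.sound isJ _ (cl x≢y x∈ y∈ z∉)
... | inj₁ tri≤2 = contradiction (≤-reflexive (sym (∣tri∣≡3 (x≢y , ∈∧∉⇒≢ x∈ z∉ , ∈∧∉⇒≢ y∈ z∉)))) (<⇒≱ (s≤s tri≤2))
... | inj₂ (inj₁ s) = ⊥-elim (¬A s)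
... | inj₂ (inj₂ s) = ⊥-elim (¬B s)

-- A point of `T` outside `B` would make `T` everything: a triple with two points outside `B` splits
-- neither `B` nor the smaller `A`, so two such points of `T` absorb every vertex.
Closed⇒⊆B : {H : Family n} {A B T : Subset n} → IsJ H A B → 2 + ∣ B ∣ ≤ n →
            Closed H T → 2 ≤ ∣ T ∣ → ∣ T ∣ < n → T ⊆ B
Closed⇒⊆B {n} {H} {A} {B} {T} isJ B+2≤n cl 2≤T T<n {c} c∈T with c ∈? B
... | yes c∈B = c∈B
... | no c∉B = contradiction (≤-trans (≤-reflexive (sym (∣⊤∣≡n n))) (p⊆q⇒∣p∣≤∣q∣ {p = ⊤} λ {z} _ → all z)) (<⇒≱ T<n)
  where
  open IsJ isJ
  second : ∃ λ c′ → c′ ∈ T × c′ ∉ B × c ≢ c′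
  second with ∃∈≢ T c 2≤T
  ... | y , y∈T , y≢c with y ∈? B
  ... | no y∉B = y , y∈T , y∉B , ≢-sym y≢c
  -- `B` misses at least two vertices, so there is a `c′` outside `B` other than `c`; as `c` and
  -- `c′` are both outside `B`, the points `c` and `y` absorb `c′`.
  ... | yes y∈B with ∃∈∖≢ B ⊤ c (subst (2 + ∣ B ∣ ≤_) (sym (∣⊤∣≡n n)) B+2≤n)
  ... | c′ , _ , c′∉B , c≢c′ = c′ , Closed-absorbs isJ cl (≢-sym y≢c) c∈T y∈T (¬split (c∉B ∘ A⊆B) (c′∉B ∘ A⊆B)) (¬split c∉B c′∉B) , c′∉B , c≢c′
    where
    ¬split : ∀ {S} → c ∉ S → c′ ∉ S → ¬ SplitSet S (tri c y c′)
    ¬split {S} c∉ c′∉ = subst (λ X → ¬ SplitSet S X) (tri-swap₂₃ c c′ y) (two-out⇒¬SplitSet c∉ c′∉)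
  all : ∀ z → z ∈ T
  all z with second
  ... | c′ , c′∈T , c′∉B , c≢c′ = Closed-absorbs isJ cl c≢c′ c∈T c′∈T
    (two-out⇒¬SplitSet (c∉B ∘ A⊆B) (c′∉B ∘ A⊆B)) (two-out⇒¬SplitSet c∉B c′∉B)

-- The argument of `Closed⇒⊆B` one level down. Inside `B`, a point of `T` outside `A` yields a
-- second one because `B` exceeds `A` by at least two, and these absorb all of `B`. Otherwise `T`
-- lies in `A`, and two of its points absorb `A`, since triples inside `A` split neither set.
Closed⇒A⊎B : {H : Family n} {A B T : Subset n} → IsJ H A B → 2 + ∣ A ∣ ≤ ∣ B ∣ → 2 + ∣ B ∣ ≤ n →
             Closed H T → 2 ≤ ∣ T ∣ → ∣ T ∣ < n → T ≡ A ⊎ T ≡ B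
Closed⇒A⊎B {n} {H} {A} {B} {T} isJ A+2≤B B+2≤n cl 2≤T T<n with any? (λ b → (b ∈? T) ×-dec ¬? (b ∈? A))
... | yes (b , b∈T , b∉A) = inj₂ (⊆-antisym T⊆B all)
  where
  open IsJ isJ
  T⊆B : T ⊆ B
  T⊆B = Closed⇒⊆B isJ B+2≤n cl 2≤T T<n
  second : ∃ λ b′ → b′ ∈ T × b′ ∉ A × b ≢ b′
  second with ∃∈≢ T b 2≤T
  ... | y , y∈T , y≢b with y ∈? A
  ... | no y∉A = y , y∈T , y∉A , ≢-sym y≢b
  ... | yes y∈A with ∃∈∖≢ A B b A+2≤B
  ... | b′ , b′∈B , b′∉A , b≢b′ = b′ , Closed-absorbs isJ cl (≢-sym y≢b) b∈T y∈T
    (subst (λ X → ¬ SplitSet A X) (tri-swap₂₃ b b′ y) (two-out⇒¬SplitSet b∉A b′∉A))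
    (all-in⇒¬SplitSet (T⊆B b∈T) (T⊆B y∈T) b′∈B) , b′∉A , b≢b′
  all : B ⊆ T
  all z∈B with second
  ... | b′ , b′∈T , b′∉A , b≢b′ = Closed-absorbs isJ cl b≢b′ b∈T b′∈T
    (two-out⇒¬SplitSet b∉A b′∉A) (all-in⇒¬SplitSet (T⊆B b∈T) (T⊆B b′∈T) z∈B)
... | no ¬∃ with ∃∈ T (≤-trans (s≤s z≤n) 2≤T)
... | a , a∈T with ∃∈≢ T a 2≤T
... | a′ , a′∈T , a′≢a = inj₁ (⊆-antisym T⊆A all)
  where
  open IsJ isJ
  T⊆A : T ⊆ A
  T⊆A {x} x∈T with x ∈? A
  ... | yes x∈A = x∈A
  ... | no x∉A = ⊥-elim (¬∃ (x , x∈T , x∉A))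
  all : A ⊆ T
  all z∈A = Closed-absorbs isJ cl (≢-sym a′≢a) a∈T a′∈T
    (all-in⇒¬SplitSet (T⊆A a∈T) (T⊆A a′∈T) z∈A)
    (all-in⇒¬SplitSet (A⊆B (T⊆A a∈T)) (A⊆B (T⊆A a′∈T)) (A⊆B z∈A))

-- Minimality of J(A,B)

Generic : ℕ → ℕ → ℕ → Set
Generic n i j = 2 + i ≤ j × 2 + j ≤ n

Admissible : ℕ → ℕ → ℕ → Set
Admissible n i j = Generic n i j ⊎ (i ≡ 2 × j ≡ 3)

splits-or-inside : {S U : Subset n} {x y z : Fin n} → S ⊆ U → ∣ U ∣ ≤ suc ∣ S ∣ → Distinct x y z →
                   x ∈ U → y ∈ U → z ∈ U → Splits S x y z ⊎ (x ∈ S × y ∈ S × z ∈ S)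
splits-or-inside {S = S} {U} {x} {y} {z} S⊆U U≤ (x≢y , x≢z , y≢z) x∈U y∈U z∈U with x ∈? S | y ∈? S | z ∈? S
... | yes x∈ | yes y∈ | yes z∈ = inj₂ (x∈ , y∈ , z∈)
... | yes x∈ | yes y∈ | no z∉ = inj₁ (inj₁ (x∈ , y∈ , z∉))
... | yes x∈ | no y∉ | yes z∈ = inj₁ (inj₂ (inj₂ (z∈ , x∈ , y∉)))
... | no x∉ | yes y∈ | yes z∈ = inj₁ (inj₂ (inj₁ (y∈ , z∈ , x∉)))
... | no x∉ | no y∉ | _ = contradiction U≤ (<⇒≱ (2+∣p∣≤ S⊆U x∈U x∉ y∈U y∉ x≢y))
... | no x∉ | yes _ | no z∉ = contradiction U≤ (<⇒≱ (2+∣p∣≤ S⊆U x∈U x∉ z∈U z∉ x≢z))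
... | yes _ | no y∉ | no z∉ = contradiction U≤ (<⇒≱ (2+∣p∣≤ S⊆U y∈U y∉ z∈U z∉ y≢z))

-- The triple is `B` itself, and `A` misses exactly one of its points, so it splits `A`.
2,3-triples : {K : Family n} {A B : Subset n} {x y z : Fin n} → ClosedPair K A B → ∣ B ∣ ≡ 3 → Distinct x y z →
              x ∈ B → y ∈ B → z ∈ B → K (tri x y z) ≡ true
2,3-triples {K = K} {A} {B} pair ∣B∣≡3 dist x∈ y∈ z∈
  with splits-or-inside A⊆B (≤-trans (≤-reflexive ∣B∣≡3) (s≤s 2≤∣A∣)) dist x∈ y∈ z∈
  where open ClosedPair pair
... | inj₁ s = Closed⇒Splits {H = K} (ClosedPair.A-closed pair) dist s
... | inj₂ (x∈A , y∈A , z∈A) = contradiction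
  (≤-trans (≤-reflexive (trans ∣B∣≡3 (sym (∣tri∣≡3 dist)))) (p⊆q⇒∣p∣≤∣q∣ (tri⊆ x∈A y∈A z∈A)))
  (<⇒≱ (ClosedPair.∣A∣<∣B∣ pair))

-- Sets closed in `K` are closed in the larger `H`, so the closed sets of `H` restrict the pair of
-- `K`. For generic sizes that pair is `A`, `B`, and leastness applies. For sizes (2,3) the set `A′`
-- may differ from `A`, but the faces of `H` depend on `B` alone: they are the triples with at least
-- two points in `B`.
IsJ-minimal : {H K : Family n} {A B A′ B′ : Subset n} → IsJ H A B → Admissible n ∣ A ∣ ∣ B ∣ →
              (∀ X → K X ≡ true → H X ≡ true) → ContainsPle 2 K → ClosedPair K A′ B′ →
              ∀ X → H X ≡ true → K X ≡ true
IsJ-minimal {n} {H} {K} {A} {B} {A′} {B′} isJ (inj₁ (A+2≤B , B+2≤n)) K⊆H pleK pair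
  with classify A-closed 2≤∣A∣ (<-trans ∣A∣<∣B∣ ∣B∣<n) | classify B-closed (≤-trans 2≤∣A∣ (<⇒≤ ∣A∣<∣B∣)) ∣B∣<n
  where
  open ClosedPair pair
  classify : ∀ {T} → Closed K T → 2 ≤ ∣ T ∣ → ∣ T ∣ < n → T ≡ A ⊎ T ≡ B
  classify cl = Closed⇒A⊎B isJ A+2≤B B+2≤n λ x≢y x∈ y∈ z∉ → K⊆H _ (cl x≢y x∈ y∈ z∉)
... | inj₁ refl | inj₂ refl = IsJ-least isJ pleK (ClosedPair.A-closed pair) (ClosedPair.B-closed pair)
... | inj₁ refl | inj₁ refl = ⊥-elim (<-irrefl refl (ClosedPair.∣A∣<∣B∣ pair))
... | inj₂ refl | inj₂ refl = ⊥-elim (<-irrefl refl (ClosedPair.∣A∣<∣B∣ pair))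
... | inj₂ refl | inj₁ refl = contradiction (IsJ.∣A∣<∣B∣ isJ) (<⇒≱ (s≤s (<⇒≤ (ClosedPair.∣A∣<∣B∣ pair))))
IsJ-minimal {n} {H} {K} {A} {B} {A′} {B′} isJ (inj₂ (∣A∣≡2 , ∣B∣≡3)) K⊆H pleK pair X HX with 5 ≤? n
-- Now |B| + 2 ≤ n, so `Closed⇒⊆B` applies; as `B′` has at least three points, it fills `B`.
... | yes 5≤n = cases (IsJ.sound isJ X HX)
  where
  open ClosedPair pair
  B′⊆B : B′ ⊆ B
  B′⊆B = Closed⇒⊆B isJ (subst (λ j → 2 + j ≤ n) (sym ∣B∣≡3) 5≤n)
    (λ x≢y x∈ y∈ z∉ → K⊆H _ (B-closed x≢y x∈ y∈ z∉)) (≤-trans 2≤∣A∣ (<⇒≤ ∣A∣<∣B∣)) ∣B∣<n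
  pairB : ClosedPair K A′ B
  pairB = subst (ClosedPair K A′)
    (⊆∧∣≥∣⇒≡ B′⊆B (≤-trans (≤-reflexive ∣B∣≡3) (≤-trans (s≤s 2≤∣A∣) ∣A∣<∣B∣))) pair
  cases : ∣ X ∣ ≤ 2 ⊎ SplitSet A X ⊎ SplitSet B X → K X ≡ true
  cases (inj₁ X≤2) = pleK X X≤2
  cases (inj₂ (inj₂ (x , y , z , x≢y , x∈ , y∈ , z∉ , refl))) = ClosedPair.B-closed pairB x≢y x∈ y∈ z∉
  cases (inj₂ (inj₁ (x , y , z , x≢y , x∈ , y∈ , z∉ , refl))) with z ∈? B
  ... | no z∉B = ClosedPair.B-closed pairB x≢y (IsJ.A⊆B isJ x∈) (IsJ.A⊆B isJ y∈) z∉B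
  ... | yes z∈B = 2,3-triples pairB ∣B∣≡3 (x≢y , ∈∧∉⇒≢ x∈ z∉ , ∈∧∉⇒≢ y∈ z∉) (IsJ.A⊆B isJ x∈) (IsJ.A⊆B isJ y∈) z∈B
-- Here `B′` misses exactly one vertex, so every triple splits `B′` or equals it, and `K` contains
-- all triples.
... | no 5≰n = cases (IsJ.sound isJ X HX)
  where
  open ClosedPair pair
  n≤4 : n ≤ 4
  n≤4 = ≤-pred (≰⇒> 5≰n)
  3≤∣B′∣ : 3 ≤ ∣ B′ ∣
  3≤∣B′∣ = ≤-trans (s≤s 2≤∣A∣) ∣A∣<∣B∣
  every : ∀ {x y z} → Distinct x y z → K (tri x y z) ≡ true
  every {x} {y} {z} dist
    with splits-or-inside {S = B′} {U = ⊤} {x} {y} {z} ⊆⊤ (≤-trans (≤-reflexive (∣⊤∣≡n n)) (≤-trans n≤4 (s≤s 3≤∣B′∣))) dist ∈⊤ ∈⊤ ∈⊤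
  ... | inj₁ s = Closed⇒Splits {H = K} B-closed dist s
  ... | inj₂ (x∈ , y∈ , z∈) = 2,3-triples pair (≤-antisym (≤-pred (≤-trans ∣B∣<n n≤4)) 3≤∣B′∣) dist x∈ y∈ z∈
  cases : ∣ X ∣ ≤ 2 ⊎ SplitSet A X ⊎ SplitSet B X → K X ≡ true
  cases (inj₁ X≤2) = pleK X X≤2
  cases (inj₂ (inj₁ (x , y , z , x≢y , x∈ , y∈ , z∉ , refl))) = every (x≢y , ∈∧∉⇒≢ x∈ z∉ , ∈∧∉⇒≢ y∈ z∉)
  cases (inj₂ (inj₂ (x , y , z , x≢y , x∈ , y∈ , z∉ , refl))) = every (x≢y , ∈∧∉⇒≢ x∈ z∉ , ∈∧∉⇒≢ y∈ z∉)

-- The set that `K` has beyond P≤2 has exactly three points, so `K` is in Pav(2). If `K` went up,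
-- `IsJ-minimal` would put the missing face `Y` into it.
IsJ⇒mGU : {H : Family n} {A B : Subset n} → IsJ H A B → Admissible n ∣ A ∣ ∣ B ∣ → mGU 2 H
IsJ⇒mGU {H = H} isJ adm = IsJ⇒GU isJ , below
  where
  below : ∀ K → H ⊋F K → StrictlyAbovePle 2 K → NGU 2 K
  below K (K⊆H , Y , HY , KY) (pleK , X , KX , X≰2) =
    Pav₂ pleK (λ Z KZ → ∣face∣≤3 isJ Z (K⊆H Z KZ)) (X , KX , ≤-antisym (∣face∣≤3 isJ X (K⊆H X KX)) (≰⇒> X≰2)) ,
    λ up → let _ , _ , pair = GoesUp⇒ClosedPair pleK up in
      contradiction (IsJ-minimal isJ adm K⊆H pleK pair Y HY) (not-¬ KY)

-- Reduction to admissible sizes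

∉∪⁅⁆ : x ∉ S ∪ ⁅ y ⁆ → x ∉ S × x ≢ y
∉∪⁅⁆ x∉ = (x∉ ∘ ∈∪ˡ) , λ { refl → x∉ ∈∪ʳ }

module _ {H : Family n} {A B : Subset n} (pair : ClosedPair H A B) where
  open ClosedPair pair

  -- Every vertex other than `c` lies in `B`. So a triple of `c`, a point of `A` and a further point
  -- splits `B` and is a face; hence `B` may be traded for `A ∪ ⁅ c ⁆`.
  coatom⇒pair : ∣ B ∣ ≡ n ∸ 1 → ∃ λ c → c ∉ A × ClosedPair H A (A ∪ ⁅ c ⁆)
  coatom⇒pair ∣B∣≡ with ∃∉ B ∣B∣<n
  ... | c , c∉B = c , (c∉B ∘ A⊆B) , record
    { 2≤∣A∣ = 2≤∣A∣
    ; A⊆B = ∈∪ˡ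
    ; ∣A∣<∣B∣ = ≤-reflexive (sym (∣p∪⁅x⁆∣≡ (c∉B ∘ A⊆B)))
    ; ∣B∣<n = ≤-<-trans (≤-trans (≤-reflexive (∣p∪⁅x⁆∣≡ (c∉B ∘ A⊆B))) ∣A∣<∣B∣) ∣B∣<n
    ; A-closed = A-closed
    ; B-closed = closed
    }
    where
    ≢c⇒∈B : ∀ {x} → x ≢ c → x ∈ B
    ≢c⇒∈B {x} x≢c with x ∈? B
    ... | yes x∈B = x∈B
    ... | no x∉B = contradiction (∖-unique {S = B} {U = ⊤} ⊆⊤ (trans (∣⊤∣≡n n) n≡) ∈⊤ x∉B ∈⊤ c∉B) x≢c
      where
      n≡ : n ≡ suc ∣ B ∣
      n≡ = trans (sym (m+[n∸m]≡n (≤-trans (s≤s z≤n) ∣B∣<n))) (cong suc (sym ∣B∣≡))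
    with-c : ∀ {x z} → x ∈ A → z ≢ c → x ≢ z → H (tri x c z) ≡ true
    with-c {x} {z} x∈A z≢c x≢z =
      trans (cong H (tri-swap₂₃ x c z)) (B-closed x≢z (A⊆B x∈A) (≢c⇒∈B z≢c) c∉B)
    closed : Closed H (A ∪ ⁅ c ⁆)
    closed {x} {y} {z} x≢y x∈ y∈ z∉ with ∉∪⁅⁆ z∉ | ∈∪⁅⁆⁻ x∈ | ∈∪⁅⁆⁻ y∈
    ... | z∉A , z≢c | inj₁ x∈A | inj₁ y∈A = A-closed x≢y x∈A y∈A z∉A
    ... | z∉A , z≢c | inj₁ x∈A | inj₂ refl = with-c x∈A z≢c (∈∧∉⇒≢ x∈A z∉A)
    ... | z∉A , z≢c | inj₂ refl | inj₁ y∈A = trans (cong H (tri-swap₁₂ x y z)) (with-c y∈A z≢c (∈∧∉⇒≢ y∈A z∉A))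
    ... | z∉A , z≢c | inj₂ refl | inj₂ y≡c = contradiction (sym y≡c) x≢y

  -- `b` is the only point of `B` outside `A`. If the third point of a triple containing `a` and `b`
  -- is outside `B`, the triple splits `B`; otherwise that point is in `A` and the triple splits
  -- `A`. So `A` may be traded for a set of two points.
  cover⇒pair : ∣ B ∣ ≡ suc ∣ A ∣ → ∃ λ a → ∃ λ b → a ≢ b × ClosedPair H (⁅ a ⁆ ∪ ⁅ b ⁆) B
  cover⇒pair ∣B∣≡ with ∃∈ A (≤-trans (s≤s z≤n) 2≤∣A∣) | ∃∈∖ A B ∣A∣<∣B∣
  ... | a , a∈A | b , b∈B , b∉A = a , b , a≢b , record
    { 2≤∣A∣ = ≤-reflexive (sym (∣⁅x⁆∪⁅y⁆∣≡2 a≢b))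
    ; A⊆B = ∪⁅⁆⊆ (λ w∈ → subst (_∈ B) (sym (x∈⁅y⁆⇒x≡y a w∈)) (A⊆B a∈A)) b∈B
    ; ∣A∣<∣B∣ = subst (_< ∣ B ∣) (sym (∣⁅x⁆∪⁅y⁆∣≡2 a≢b)) (≤-trans (s≤s 2≤∣A∣) ∣A∣<∣B∣)
    ; ∣B∣<n = ∣B∣<n
    ; A-closed = closed
    ; B-closed = B-closed
    }
    where
    a≢b : a ≢ b
    a≢b = ∈∧∉⇒≢ a∈A b∉A
    ab-face : ∀ {z} → z ≢ a → z ≢ b → H (tri a b z) ≡ true
    ab-face {z} z≢a z≢b with z ∈? B
    ... | no z∉B = B-closed a≢b (A⊆B a∈A) b∈B z∉B
    ... | yes z∈B with z ∈? A
    ... | yes z∈A = trans (cong H (tri-swap₂₃ a b z)) (A-closed (≢-sym z≢a) a∈A z∈A b∉A)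
    ... | no z∉A = contradiction (∖-unique A⊆B ∣B∣≡ z∈B z∉A b∈B b∉A) z≢b
    closed : Closed H (⁅ a ⁆ ∪ ⁅ b ⁆)
    closed {x} {y} {z} x≢y x∈ y∈ z∉ with ∉∪⁅⁆ z∉ | ∈∪⁅⁆⁻ x∈ | ∈∪⁅⁆⁻ y∈
    ... | z∉a , z≢b | inj₂ x≡b | inj₂ y≡b = contradiction (trans x≡b (sym y≡b)) x≢y
    ... | z∉a , z≢b | inj₁ x∈a | inj₁ y∈a = contradiction (trans (x∈⁅y⁆⇒x≡y a x∈a) (sym (x∈⁅y⁆⇒x≡y a y∈a))) x≢y
    ... | z∉a , z≢b | inj₁ x∈a | inj₂ refl with refl ← x∈⁅y⁆⇒x≡y a x∈a = ab-face (x∉⁅y⁆⇒x≢y z∉a) z≢b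
    ... | z∉a , z≢b | inj₂ refl | inj₁ y∈a with refl ← x∈⁅y⁆⇒x≡y a y∈a =
      trans (cong H (tri-swap₁₂ x y z)) (ab-face (x∉⁅y⁆⇒x≢y z∉a) z≢b)

<⇒≡pred⊎2+≤ : ∀ {j n} → j < n → j ≡ n ∸ 1 ⊎ 2 + j ≤ n
<⇒≡pred⊎2+≤ (s≤s j≤) with m≤n⇒m<n∨m≡n j≤
... | inj₁ j< = inj₂ (s≤s j<)
... | inj₂ j≡ = inj₁ j≡

AdmissiblePair : Family n → Set
AdmissiblePair {n} H = ∃ λ A → ∃ λ B → ClosedPair H A B × Admissible n ∣ A ∣ ∣ B ∣

-- Once `A` is traded for two points, the sizes are admissible if |B| = 3 or 4 ≤ |B| ≤ n - 2. In the
-- remaining case |B| = n - 1, and trading `B` as well leads to (2,3).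
cover⇒admissible : {H : Family n} {A B : Subset n} → ClosedPair H A B → ∣ B ∣ ≡ suc ∣ A ∣ → AdmissiblePair H
cover⇒admissible {B = B} pair ∣B∣≡ with cover⇒pair pair ∣B∣≡
... | a , b , a≢b , pair′ with m≤n⇒m<n∨m≡n (ClosedPair.∣A∣<∣B∣ pair′) | <⇒≡pred⊎2+≤ (ClosedPair.∣B∣<n pair′)
... | inj₂ 3≡B | _ = _ , B , pair′ , inj₂ (∣⁅x⁆∪⁅y⁆∣≡2 a≢b , trans (sym 3≡B) (cong suc (∣⁅x⁆∪⁅y⁆∣≡2 a≢b)))
... | inj₁ 4≤B | inj₂ B+2≤n = _ , B , pair′ , inj₁ (4≤B , B+2≤n)
... | inj₁ 4≤B | inj₁ B≡ with coatom⇒pair pair′ B≡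
... | c , c∉ , pair″ = _ , _ , pair″ , inj₂ (∣⁅x⁆∪⁅y⁆∣≡2 a≢b , trans (∣p∪⁅x⁆∣≡ c∉) (cong suc (∣⁅x⁆∪⁅y⁆∣≡2 a≢b)))

ClosedPair⇒admissible : {H : Family n} {A B : Subset n} → ClosedPair H A B → AdmissiblePair H
ClosedPair⇒admissible pair with <⇒≡pred⊎2+≤ (ClosedPair.∣B∣<n pair) | m≤n⇒m<n∨m≡n (ClosedPair.∣A∣<∣B∣ pair)
... | inj₂ B+2≤n | inj₁ A+2≤B = _ , _ , pair , inj₁ (A+2≤B , B+2≤n)
... | inj₂ _ | inj₂ A+1≡B = cover⇒admissible pair (sym A+1≡B)
-- The new upper set has just one point more than `A`, which is the case settled by
-- `cover⇒admissible`.
... | inj₁ B≡ | _ with coatom⇒pair pair B≡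
... | c , c∉ , pair′ = cover⇒admissible pair′ (∣p∪⁅x⁆∣≡ c∉)

-- Images under permutations

module _ (σ : Permutation′ n) where

  lookup-image : ∀ X y → lookup (image σ X) y ≡ lookup X (σ ⟨$⟩ˡ y)
  lookup-image X y = lookup∘tabulate _ y

  ∈image⁻ : y ∈ image σ X → σ ⟨$⟩ˡ y ∈ X
  ∈image⁻ {y} {X} y∈ = lookup⇒[]= _ X (trans (sym (lookup-image X y)) ([]=⇒lookup y∈))

  ˡ∈⇒∈image : σ ⟨$⟩ˡ y ∈ X → y ∈ image σ X
  ˡ∈⇒∈image {y} {X} y∈ = lookup⇒[]= y _ (trans (lookup-image X y) ([]=⇒lookup y∈))

  ∈image⁺ : x ∈ X → σ ⟨$⟩ʳ x ∈ image σ X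
  ∈image⁺ {X = X} x∈ = ˡ∈⇒∈image (subst (_∈ X) (sym (inverseˡ σ)) x∈)

  ʳ∈image⁻ : σ ⟨$⟩ʳ x ∈ image σ X → x ∈ X
  ʳ∈image⁻ {X = X} x∈ = subst (_∈ X) (inverseˡ σ) (∈image⁻ x∈)

  ʳ-injective : σ ⟨$⟩ʳ x ≡ σ ⟨$⟩ʳ y → x ≡ y
  ʳ-injective eq = trans (sym (inverseˡ σ)) (trans (cong (σ ⟨$⟩ˡ_) eq) (inverseˡ σ))

  ˡ-injective : σ ⟨$⟩ˡ x ≡ σ ⟨$⟩ˡ y → x ≡ y
  ˡ-injective eq = trans (sym (inverseʳ σ)) (trans (cong (σ ⟨$⟩ʳ_) eq) (inverseʳ σ))

  image-tri : ∀ x y z → image σ (tri x y z) ≡ tri (σ ⟨$⟩ʳ x) (σ ⟨$⟩ʳ y) (σ ⟨$⟩ʳ z)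
  image-tri x y z = ⊆-antisym to (tri⊆
    (∈image⁺ {X = tri x y z} ∈tri₁) (∈image⁺ {X = tri x y z} (∈tri₂ {x = x})) (∈image⁺ {X = tri x y z} (∈tri₃ {x = x} {y})))
    where
    to : image σ (tri x y z) ⊆ tri (σ ⟨$⟩ʳ x) (σ ⟨$⟩ʳ y) (σ ⟨$⟩ʳ z)
    to {w} w∈ = subst (_∈ _) (inverseʳ σ) (go (∈tri⁻ (∈image⁻ w∈)))
      where
      go : ∀ {v} → v ≡ x ⊎ v ≡ y ⊎ v ≡ z → σ ⟨$⟩ʳ v ∈ tri (σ ⟨$⟩ʳ x) (σ ⟨$⟩ʳ y) (σ ⟨$⟩ʳ z)
      go (inj₁ refl) = ∈tri₁
      go (inj₂ (inj₁ refl)) = ∈tri₂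
      go (inj₂ (inj₂ refl)) = ∈tri₃

image-flip : (σ : Permutation′ n) (X : Subset n) → image σ (image (flip σ) X) ≡ X
image-flip σ X = ⊆-antisym
  (λ w∈ → subst (_∈ X) (inverseʳ σ) (∈image⁻ (flip σ) {X = X} (∈image⁻ σ {X = image (flip σ) X} w∈)))
  (λ w∈ → ˡ∈⇒∈image σ {X = image (flip σ) X} (ˡ∈⇒∈image (flip σ) {X = X} (subst (_∈ X) (sym (inverseʳ σ)) w∈)))

-- Written as a sum of indicators, cardinality inherits invariance under permutations from finite
-- sums.
∣p∣≡∑ : (p : Subset n) → ∣ p ∣ ≡ sum (λ i → if lookup p i then 1 else 0)
∣p∣≡∑ [] = refl
∣p∣≡∑ (true ∷ p) = cong suc (∣p∣≡∑ p)
∣p∣≡∑ (false ∷ p) = ∣p∣≡∑ p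

∣image∣ : (σ : Permutation′ n) (X : Subset n) → ∣ image σ X ∣ ≡ ∣ X ∣
∣image∣ σ X = begin
  ∣ image σ X ∣                                             ≡⟨ ∣p∣≡∑ (image σ X) ⟩
  sum (λ y → if lookup (image σ X) y then 1 else 0)         ≡⟨ sum-permute _ σ ⟩
  sum (λ x → if lookup (image σ X) (σ ⟨$⟩ʳ x) then 1 else 0) ≡⟨ sum-cong-≋ same ⟩
  sum (λ x → if lookup X x then 1 else 0)                   ≡⟨ ∣p∣≡∑ X ⟨
  ∣ X ∣                                                     ∎
  where
  open ≡-Reasoning
  same : ∀ x → (if lookup (image σ X) (σ ⟨$⟩ʳ x) then 1 else 0) ≡ (if lookup X x then 1 else 0)
  same x = cong (if_then 1 else 0) (trans (lookup-image σ X (σ ⟨$⟩ʳ x)) (cong (lookup X) (inverseˡ σ)))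

Iso-sym : {H K : Family n} → Iso H K → Iso K H
Iso-sym {H = H} {K} (σ , iso) = flip σ , λ X → trans (sym (iso (image (flip σ) X))) (cong K (image-flip σ X))

Closed-image : {H K : Family n} {T : Subset n} ((σ , _) : Iso H K) → Closed H T → Closed K (image σ T)
Closed-image {H = H} {K} (σ , iso) cl {x} {y} {z} x≢y x∈ y∈ z∉ = begin
  K (tri x y z)                                             ≡⟨ cong K (sym back) ⟩
  K (image σ (tri (σ ⟨$⟩ˡ x) (σ ⟨$⟩ˡ y) (σ ⟨$⟩ˡ z)))        ≡⟨ iso _ ⟩
  H (tri (σ ⟨$⟩ˡ x) (σ ⟨$⟩ˡ y) (σ ⟨$⟩ˡ z))                  ≡⟨ cl (x≢y ∘ ˡ-injective σ) (∈image⁻ σ x∈) (∈image⁻ σ y∈) (z∉ ∘ ˡ∈⇒∈image σ) ⟩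
  true                                                      ∎
  where
  open ≡-Reasoning
  back : image σ (tri (σ ⟨$⟩ˡ x) (σ ⟨$⟩ˡ y) (σ ⟨$⟩ˡ z)) ≡ tri x y z
  back = trans (image-tri σ _ _ _)
    (cong₂ _∪_ (cong₂ _∪_ (cong ⁅_⁆ (inverseʳ σ)) (cong ⁅_⁆ (inverseʳ σ))) (cong ⁅_⁆ (inverseʳ σ)))

SplitSet-image⁻ : {A X : Subset n} (σ : Permutation′ n) → SplitSet (image σ A) (image σ X) → SplitSet A X
SplitSet-image⁻ {A = A} {X} σ (x , y , z , x≢y , x∈ , y∈ , z∉ , eq) =
  σ ⟨$⟩ˡ x , σ ⟨$⟩ˡ y , σ ⟨$⟩ˡ z , (x≢y ∘ ˡ-injective σ) ,
  ∈image⁻ σ {X = A} x∈ , ∈image⁻ σ {X = A} y∈ , (z∉ ∘ ˡ∈⇒∈image σ {X = A}) ,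
  trans (sym (image-flip (flip σ) X)) (trans (cong (image (flip σ)) eq) (image-tri (flip σ) x y z))

-- This carries the property from initial segments, where J(i,j,n) has it, to any `A` and `B` that
-- `σ` sorts into them.
IsJ-preimage : {H : Family n} {A B : Subset n} (σ : Permutation′ n) → IsJ H (image σ A) (image σ B) → IsJ (H ∘ image σ) A B
IsJ-preimage {n = n} {H} {A} {B} σ isJ = record
  { ple = λ X X≤2 → ple _ (subst (_≤ 2) (sym (∣image∣ σ X)) X≤2)
  ; pair = record
    { 2≤∣A∣ = subst (2 ≤_) (∣image∣ σ A) 2≤∣A∣
    ; A⊆B = λ x∈A → ʳ∈image⁻ σ {X = B} (A⊆B (∈image⁺ σ {X = A} x∈A))
    ; ∣A∣<∣B∣ = subst (λ i → i < ∣ B ∣) (∣image∣ σ A) (subst (∣ image σ A ∣ <_) (∣image∣ σ B) ∣A∣<∣B∣)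
    ; ∣B∣<n = subst (_< n) (∣image∣ σ B) ∣B∣<n
    ; A-closed = closed A A-closed
    ; B-closed = closed B B-closed
    }
  ; sound = sound′
  }
  where
  open IsJ isJ
  closed : ∀ T → Closed H (image σ T) → Closed (H ∘ image σ) T
  closed T cl {x} {y} {z} x≢y x∈ y∈ z∉ = trans (cong H (image-tri σ x y z))
    (cl (x≢y ∘ ʳ-injective σ) (∈image⁺ σ {X = T} x∈) (∈image⁺ σ {X = T} y∈) (z∉ ∘ ʳ∈image⁻ σ {X = T}))
  sound′ : ∀ X → H (image σ X) ≡ true → ∣ X ∣ ≤ 2 ⊎ SplitSet A X ⊎ SplitSet B X
  sound′ X HX with sound (image σ X) HX
  ... | inj₁ X≤2 = inj₁ (subst (_≤ 2) (∣image∣ σ X) X≤2)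
  ... | inj₂ (inj₁ s) = inj₂ (inj₁ (SplitSet-image⁻ σ s))
  ... | inj₂ (inj₂ s) = inj₂ (inj₂ (SplitSet-image⁻ σ s))

-- Sorting a nested pair of sets into initial segments.

initial : (n i : ℕ) → Subset n
initial n i = tabulate (λ k → toℕ k <ᵇ i)

<⇒<ᵇ≡true : ∀ {k l} → k < l → (k <ᵇ l) ≡ true
<⇒<ᵇ≡true k<l = Equivalence.to T-≡ (<⇒<ᵇ k<l)

≥⇒<ᵇ≡false : ∀ {k l} → l ≤ k → (k <ᵇ l) ≡ false
≥⇒<ᵇ≡false z≤n = refl
≥⇒<ᵇ≡false (s≤s l≤k) = ≥⇒<ᵇ≡false l≤k

∈initial⁺ : ∀ {i} {k : Fin n} → toℕ k < i → k ∈ initial n i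
∈initial⁺ {k = k} k<i = lookup⇒[]= k _ (trans (lookup∘tabulate _ k) (<⇒<ᵇ≡true k<i))

∈initial⁻ : ∀ {i} {k : Fin n} → k ∈ initial n i → toℕ k < i
∈initial⁻ {k = k} k∈ = <ᵇ⇒< (toℕ k) _ (Equivalence.from T-≡ (trans (sym (lookup∘tabulate _ k)) ([]=⇒lookup k∈)))

∣initial∣ : ∀ n {i} → i ≤ n → ∣ initial n i ∣ ≡ i
∣initial∣ zero z≤n = refl
∣initial∣ (suc n) z≤n = ∣initial∣ n z≤n
∣initial∣ (suc n) (s≤s i≤n) = cong suc (∣initial∣ n i≤n)

-- Inserting a position `p` shifts only the positions from `p` on: a threshold k ≤ p stays, and in
-- `punchIn-<ᵇ-above` a threshold k ≥ p moves up by one.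
punchIn-<ᵇ-below : ∀ {k} (p : Fin (suc n)) (y : Fin n) → k ≤ toℕ p → (toℕ (punchIn p y) <ᵇ k) ≡ (toℕ y <ᵇ k)
punchIn-<ᵇ-below {k = zero} p y _ = refl
punchIn-<ᵇ-below {k = suc _} (suc p) zero (s≤s k≤p) = refl
punchIn-<ᵇ-below {k = suc _} (suc p) (suc y) (s≤s k≤p) = punchIn-<ᵇ-below p y k≤p

punchIn-<ᵇ-above : ∀ {k} (p : Fin (suc n)) (y : Fin n) → toℕ p ≤ k → (toℕ (punchIn p y) <ᵇ suc k) ≡ (toℕ y <ᵇ k)
punchIn-<ᵇ-above zero y p≤k = refl
punchIn-<ᵇ-above (suc p) zero (s≤s p≤k) = refl
punchIn-<ᵇ-above (suc p) (suc y) (s≤s p≤k) = punchIn-<ᵇ-above p y p≤k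

-- The equation of Booleans says at once that `A` goes to the first |A| positions and that nothing
-- else does.
Ranks : Permutation′ n → Subset n → Set
Ranks σ A = ∀ x → lookup A x ≡ (toℕ (σ ⟨$⟩ʳ x) <ᵇ ∣ A ∣)

Ranks⇒image≡initial : (σ : Permutation′ n) (A : Subset n) → Ranks σ A → image σ A ≡ initial n ∣ A ∣
Ranks⇒image≡initial σ A ranks = tabulate-cong λ y →
  trans (ranks (σ ⟨$⟩ˡ y)) (cong (λ k → toℕ k <ᵇ ∣ A ∣) (inverseʳ σ))

module _ (σ : Permutation′ n) (A : Subset n) (ranks : Ranks σ A) where

  Ranks-insert-in : ∀ p → toℕ p ≤ ∣ A ∣ → Ranks (insert zero p σ) (true ∷ A)
  Ranks-insert-in p p≤ zero = sym (<⇒<ᵇ≡true (s≤s p≤))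
  Ranks-insert-in p p≤ (suc x) = trans (ranks x) (trans (sym (punchIn-<ᵇ-above p _ p≤))
    (cong (λ k → toℕ k <ᵇ suc ∣ A ∣) (sym (insert-punchIn zero p σ x))))

  Ranks-insert-out : ∀ p → ∣ A ∣ ≤ toℕ p → Ranks (insert zero p σ) (false ∷ A)
  Ranks-insert-out p ≤p zero = sym (≥⇒<ᵇ≡false ≤p)
  Ranks-insert-out p ≤p (suc x) = trans (ranks x) (trans (sym (punchIn-<ᵇ-below p _ ≤p))
    (cong (λ k → toℕ k <ᵇ ∣ A ∣) (sym (insert-punchIn zero p σ x))))

-- Induction on the number of vertices. The new vertex is inserted at position 0 if it is in `A`, at
-- |A| if it is only in `B`, and at |B| otherwise; each choice is on the correct side of both
-- thresholds.
sorting-permutation : (A B : Subset n) → A ⊆ B → ∃ λ σ → Ranks σ A × Ranks σ B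
sorting-permutation [] [] _ = id , (λ ()) , λ ()
sorting-permutation (a ∷ A) (b ∷ B) A⊆B with sorting-permutation A B (drop-∷-⊆ A⊆B)
sorting-permutation (true ∷ A) (true ∷ B) A⊆B | σ , rA , rB =
  insert zero zero σ , Ranks-insert-in σ A rA zero z≤n , Ranks-insert-in σ B rB zero z≤n
sorting-permutation (true ∷ A) (false ∷ B) A⊆B | _ with () ← []=⇒lookup (A⊆B here)
sorting-permutation (false ∷ A) (true ∷ B) A⊆B | σ , rA , rB = insert zero p σ ,
  Ranks-insert-out σ A rA p (≤-reflexive (sym p≡)) ,
  Ranks-insert-in σ B rB p (≤-trans (≤-reflexive p≡) (p⊆q⇒∣p∣≤∣q∣ (drop-∷-⊆ A⊆B)))
  where
  p = fromℕ< (s≤s (∣p∣≤n A))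
  p≡ = toℕ-fromℕ< (s≤s (∣p∣≤n A))
sorting-permutation (false ∷ A) (false ∷ B) A⊆B | σ , rA , rB = insert zero p σ ,
  Ranks-insert-out σ A rA p (≤-trans (p⊆q⇒∣p∣≤∣q∣ (drop-∷-⊆ A⊆B)) (≤-reflexive (sym p≡))) ,
  Ranks-insert-out σ B rB p (≤-reflexive (sym p≡))
  where
  p = fromℕ< (s≤s (∣p∣≤n B))
  p≡ = toℕ-fromℕ< (s≤s (∣p∣≤n B))

-- The complexes J(i,j,n)

isYes⇒ : {P : Set} (P? : Dec P) → isYes P? ≡ true → P
isYes⇒ (yes p) _ = p

⇒isYes : {P : Set} (P? : Dec P) → P → isYes P? ≡ true
⇒isYes (yes _) _ = refl
⇒isYes (no ¬p) p = contradiction p ¬p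

J⇒JSet : ∀ {i j} {X : Subset n} → J i j n X ≡ true → JSet n i j X
J⇒JSet = isYes⇒ _

JSet⇒J : ∀ {i j} {X : Subset n} → JSet n i j X → J i j n X ≡ true
JSet⇒J = ⇒isYes _

Type1⁺ : ∀ {i j} {x y z : Fin n} → x ≢ y → toℕ x < i → toℕ y < i → i ≤ toℕ z → toℕ z < j → Type1 i j (tri x y z)
Type1⁺ {x = x} {y} {z} x≢y x<i y<i i≤z z<j with <-cmp (toℕ x) (toℕ y)
... | tri< x<y _ _ = x , y , z , (s≤s x<y , y<i , s≤s i≤z , z<j) , refl
... | tri≈ _ x≡y _ = contradiction (toℕ-injective x≡y) x≢y
... | tri> _ _ y<x = y , x , z , (s≤s y<x , x<i , s≤s i≤z , z<j) , tri-swap₁₂ x y z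

Type1⇒SplitSet : ∀ {i j} {X : Subset n} → Type1 i j X → SplitSet (initial n i) X
Type1⇒SplitSet (a , a′ , b , (a<a′ , a′≤i , i<b , _) , eq) =
  a , a′ , b , (λ { refl → <-irrefl refl a<a′ }) , ∈initial⁺ (≤-trans (<⇒≤ a<a′) a′≤i) , ∈initial⁺ a′≤i ,
  (λ b∈ → <⇒≱ i<b (∈initial⁻ b∈)) , eq

∉initial⁻ : ∀ {i} {k : Fin n} → k ∉ initial n i → i ≤ toℕ k
∉initial⁻ k∉ = ≮⇒≥ λ k<i → k∉ (∈initial⁺ k<i)

IsJ-J : ∀ {i j} → 2 ≤ i → i < j → j < n → IsJ (J i j n) (initial n i) (initial n j)
IsJ-J {n} {i} {j} 2≤i i<j j<n = record
  { ple = λ X X≤2 → JSet⇒J (inj₁ X≤2)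
  ; pair = record
    { 2≤∣A∣ = subst (2 ≤_) (sym ∣Ai∣) 2≤i
    ; A⊆B = i⊆j
    ; ∣A∣<∣B∣ = ≤-trans (s≤s (≤-reflexive ∣Ai∣)) (≤-trans i<j (≤-reflexive (sym ∣Aj∣)))
    ; ∣B∣<n = subst (_< n) (sym ∣Aj∣) j<n
    ; A-closed = i-closed
    ; B-closed = j-closed
    }
  ; sound = λ X JX → sound X (J⇒JSet JX)
  }
  where
  ∣Ai∣ : ∣ initial n i ∣ ≡ i
  ∣Ai∣ = ∣initial∣ n (<⇒≤ (<-trans i<j j<n))
  ∣Aj∣ : ∣ initial n j ∣ ≡ j
  ∣Aj∣ = ∣initial∣ n (<⇒≤ j<n)
  i⊆j : initial n i ⊆ initial n j
  i⊆j x∈ = ∈initial⁺ (<-trans (∈initial⁻ x∈) i<j)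
  j-closed : Closed (J i j n) (initial n j)
  j-closed {x} {y} {z} x≢y x∈ y∈ z∉ = JSet⇒J (inj₂ (inj₂
    (Type1⁺ x≢y (∈initial⁻ x∈) (∈initial⁻ y∈) (∉initial⁻ z∉) (toℕ<n z))))
  i-closed : Closed (J i j n) (initial n i)
  -- `Type1 i j` reaches third points only up to j. Beyond that, the triple has two points in the
  -- larger segment and is a face of the second kind.
  i-closed {x} {y} {z} x≢y x∈ y∈ z∉ with z ∈? initial n j
  ... | yes z∈j = JSet⇒J (inj₂ (inj₁ (Type1⁺ x≢y (∈initial⁻ x∈) (∈initial⁻ y∈) (∉initial⁻ z∉) (∈initial⁻ z∈j))))
  ... | no z∉j = j-closed x≢y (i⊆j x∈) (i⊆j y∈) z∉j
  sound : ∀ X → JSet n i j X → ∣ X ∣ ≤ 2 ⊎ SplitSet (initial n i) X ⊎ SplitSet (initial n j) X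
  sound X (inj₁ X≤2) = inj₁ X≤2
  sound X (inj₂ (inj₁ t)) = inj₂ (inj₁ (Type1⇒SplitSet t))
  sound X (inj₂ (inj₂ t)) = inj₂ (inj₂ (Type1⇒SplitSet t))

-- The index set Q

-- The condition i < j - 1 < n - 2 reads i + 2 ≤ j ≤ n - 2. Truncated subtraction does no harm,
-- since the inequalities force both differences to be positive.
InQ⇒Admissible : ∀ {i j} → InQ n i j → Admissible n i j
InQ⇒Admissible {zero} (inj₁ (_ , _ , ()))
InQ⇒Admissible {suc zero} (inj₁ (_ , _ , ()))
InQ⇒Admissible {suc (suc n)} {j = suc j} (inj₁ (_ , i<j , j<n)) = inj₁ (s≤s i<j , s≤s (s≤s j<n))
InQ⇒Admissible (inj₂ eqs) = inj₂ eqs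

Admissible⇒InQ : ∀ {i j} → 2 ≤ i → Admissible n i j → InQ n i j
Admissible⇒InQ 2≤i (inj₁ (s≤s i<j , s≤s (s≤s j<n))) = inj₁ (2≤i , i<j , j<n)
Admissible⇒InQ 2≤i (inj₂ eqs) = inj₂ eqs

InQ⇒bounds : ∀ {i j} → 4 ≤ n → InQ n i j → 2 ≤ i × i < j × j < n
InQ⇒bounds 4≤n q@(inj₁ (2≤i , _)) with InQ⇒Admissible q
... | inj₁ (i+2≤j , j+2≤n) = 2≤i , <⇒≤ i+2≤j , <⇒≤ j+2≤n
... | inj₂ (refl , refl) = ≤-refl , ≤-refl , 4≤n
InQ⇒bounds 4≤n (inj₂ (refl , refl)) = ≤-refl , ≤-refl , 4≤n

InQ⇒IsJ : ∀ {i j} → 4 ≤ n → InQ n i j → IsJ (J i j n) (initial n i) (initial n j)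
InQ⇒IsJ 4≤n q with InQ⇒bounds 4≤n q
... | 2≤i , i<j , j<n = IsJ-J 2≤i i<j j<n

InQ⇒mGU : ∀ {i j} → 4 ≤ n → InQ n i j → mGU 2 (J i j n)
InQ⇒mGU {n} {i} {j} 4≤n q with InQ⇒bounds 4≤n q
... | 2≤i , i<j , j<n = IsJ⇒mGU (IsJ-J 2≤i i<j j<n)
  (subst₂ (Admissible n) (sym (∣initial∣ n (<⇒≤ (<-trans i<j j<n)))) (sym (∣initial∣ n (<⇒≤ j<n))) (InQ⇒Admissible q))

-- Representatives of the isomorphism classes.

≡true-antisym : {a b : Bool} → (a ≡ true → b ≡ true) → (b ≡ true → a ≡ true) → a ≡ b
≡true-antisym {true} to from = sym (to refl)
≡true-antisym {false} {true} to from = from refl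
≡true-antisym {false} {false} to from = refl

-- Leastness gives K ⊆ H. Were the inclusion strict, minimality of `H` would forbid `K` to go up,
-- but every J(A,B) does.
mGU⇒≡J : {H K : Family n} {A B : Subset n} → mGU 2 H → ClosedPair H A B → IsJ K A B → ∀ X → K X ≡ H X
mGU⇒≡J {H = H} {K} (((_ , _ , pleH) , _) , minimal) pair isJ X = ≡true-antisym (K⊆H X) λ HX → ¬-not λ KX →
  proj₂ (minimal K (K⊆H , X , HX , KX) K-above) (proj₂ (IsJ⇒GU isJ))
  where
  K⊆H : ∀ X → K X ≡ true → H X ≡ true
  K⊆H = IsJ-least isJ pleH (ClosedPair.A-closed pair) (ClosedPair.B-closed pair)
  K-above : StrictlyAbovePle 2 K
  K-above with ∃-face₃ isJ
  ... | Y , KY , ∣Y∣≡3 = IsJ.ple isJ , Y , KY , λ Y≤2 → <⇒≱ (s≤s Y≤2) (≤-reflexive (sym ∣Y∣≡3))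

Ranks⇒IsJ : {A B : Subset n} (σ : Permutation′ n) → 4 ≤ n → InQ n ∣ A ∣ ∣ B ∣ → Ranks σ A → Ranks σ B →
            IsJ (J ∣ A ∣ ∣ B ∣ n ∘ image σ) A B
Ranks⇒IsJ {n} {A} {B} σ 4≤n q rankA rankB = IsJ-preimage σ (subst₂ (IsJ (J ∣ A ∣ ∣ B ∣ n))
  (sym (Ranks⇒image≡initial σ A rankA)) (sym (Ranks⇒image≡initial σ B rankB)) (InQ⇒IsJ 4≤n q))

-- As `H` goes up, it has a closed pair of admissible sizes. A sorting permutation turns
-- J(|A|,|B|,n) into J(A,B) for this pair, which is `H` by `mGU⇒≡J`.
mGU⇒Iso-J : 4 ≤ n → (H : Family n) → mGU 2 H → ∃ λ (q : Q n) → Iso H (JQ n q)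
mGU⇒Iso-J {n} 4≤n H m@(((_ , _ , pleH) , up) , _) =
  from-pair (ClosedPair⇒admissible (proj₂ (proj₂ (GoesUp⇒ClosedPair pleH up))))
  where
  from-pair : AdmissiblePair H → ∃ λ (q : Q n) → Iso H (JQ n q)
  from-pair (A , B , pair , adm) = (∣ A ∣ , ∣ B ∣ , q) , relabel (sorting-permutation A B (ClosedPair.A⊆B pair))
    where
    q : InQ n ∣ A ∣ ∣ B ∣
    q = Admissible⇒InQ (ClosedPair.2≤∣A∣ pair) adm
    relabel : (∃ λ σ → Ranks σ A × Ranks σ B) → Iso H (J ∣ A ∣ ∣ B ∣ n)
    relabel (σ , rankA , rankB) = σ , mGU⇒≡J m pair (Ranks⇒IsJ σ 4≤n q rankA rankB)

-- An isomorphism carries `A` and `B` to closed sets of `K`, which can only be `A′` and `B′`; the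
-- order of the sizes decides which is which.
Iso-IsJ-sizes : {H K : Family n} {A B A′ B′ : Subset n} → IsJ H A B → IsJ K A′ B′ → Generic n ∣ A′ ∣ ∣ B′ ∣ →
                Iso H K → ∣ A ∣ ≡ ∣ A′ ∣ × ∣ B ∣ ≡ ∣ B′ ∣
Iso-IsJ-sizes {n} {H} {K} {A} {B} {A′} {B′} isJ isJ′ (A′+2≤B′ , B′+2≤n) iso@(σ , _) =
  combine (size A 2≤∣A∣ (<-trans ∣A∣<∣B∣ ∣B∣<n) A-closed) (size B (≤-trans 2≤∣A∣ (<⇒≤ ∣A∣<∣B∣)) ∣B∣<n B-closed)
  where
  open IsJ isJ
  size : ∀ T → 2 ≤ ∣ T ∣ → ∣ T ∣ < n → Closed H T → ∣ T ∣ ≡ ∣ A′ ∣ ⊎ ∣ T ∣ ≡ ∣ B′ ∣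
  size T 2≤T T<n cl = map (λ eq → trans (sym (∣image∣ σ T)) (cong ∣_∣ eq)) (λ eq → trans (sym (∣image∣ σ T)) (cong ∣_∣ eq))
    (Closed⇒A⊎B {T = image σ T} isJ′ A′+2≤B′ B′+2≤n (Closed-image {H = H} {K} {T} iso cl)
      (subst (2 ≤_) (sym (∣image∣ σ T)) 2≤T) (subst (_< n) (sym (∣image∣ σ T)) T<n))
  combine : ∣ A ∣ ≡ ∣ A′ ∣ ⊎ ∣ A ∣ ≡ ∣ B′ ∣ → ∣ B ∣ ≡ ∣ A′ ∣ ⊎ ∣ B ∣ ≡ ∣ B′ ∣ → ∣ A ∣ ≡ ∣ A′ ∣ × ∣ B ∣ ≡ ∣ B′ ∣
  combine (inj₁ A≡A′) (inj₂ B≡B′) = A≡A′ , B≡B′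
  combine (inj₁ A≡A′) (inj₁ B≡A′) = ⊥-elim (<-irrefl (trans A≡A′ (sym B≡A′)) ∣A∣<∣B∣)
  combine (inj₂ A≡B′) (inj₂ B≡B′) = ⊥-elim (<-irrefl (trans A≡B′ (sym B≡B′)) ∣A∣<∣B∣)
  combine (inj₂ A≡B′) (inj₁ B≡A′) =
    ⊥-elim (<-irrefl refl (<-trans (subst₂ _<_ A≡B′ B≡A′ ∣A∣<∣B∣) (IsJ.∣A∣<∣B∣ isJ′)))

Iso-J-generic : ∀ {i j i′ j′} → 4 ≤ n → InQ n i j → InQ n i′ j′ → Generic n i′ j′ →
                Iso (J i j n) (J i′ j′ n) → i ≡ i′ × j ≡ j′
Iso-J-generic {n} {i} {j} {i′} {j′} 4≤n q q′ g iso =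
  trans (sym (∣i∣ q)) (trans (proj₁ sizes) (∣i∣ q′)) , trans (sym (∣j∣ q)) (trans (proj₂ sizes) (∣j∣ q′))
  where
  ∣i∣ : ∀ {i j} → InQ n i j → ∣ initial n i ∣ ≡ i
  ∣i∣ q = let _ , i<j , j<n = InQ⇒bounds 4≤n q in ∣initial∣ n (<⇒≤ (<-trans i<j j<n))
  ∣j∣ : ∀ {i j} → InQ n i j → ∣ initial n j ∣ ≡ j
  ∣j∣ q = let _ , _ , j<n = InQ⇒bounds 4≤n q in ∣initial∣ n (<⇒≤ j<n)
  sizes : ∣ initial n i ∣ ≡ ∣ initial n i′ ∣ × ∣ initial n j ∣ ≡ ∣ initial n j′ ∣
  sizes = Iso-IsJ-sizes (InQ⇒IsJ 4≤n q) (InQ⇒IsJ 4≤n q′)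
    (subst₂ (Generic n) (sym (∣i∣ q′)) (sym (∣j∣ q′)) g) iso

Iso-J⇒≡ : 4 ≤ n → (q q′ : Q n) → Iso (JQ n q) (JQ n q′) → fstQ n q ≡ fstQ n q′ × sndQ n q ≡ sndQ n q′
Iso-J⇒≡ {n} 4≤n (i , j , q) (i′ , j′ , q′) iso = cases (InQ⇒Admissible q) (InQ⇒Admissible q′)
  where
  cases : Admissible n i j → Admissible n i′ j′ → i ≡ i′ × j ≡ j′
  cases _ (inj₁ g′) = Iso-J-generic 4≤n q q′ g′ iso
  cases (inj₂ (i≡2 , j≡3)) (inj₂ (i′≡2 , j′≡3)) = trans i≡2 (sym i′≡2) , trans j≡3 (sym j′≡3)
  -- The generic complex has to be the target, so the isomorphism is reversed.
  cases (inj₁ g) (inj₂ _) =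
    let i′≡i , j′≡j = Iso-J-generic 4≤n q′ q g (Iso-sym {H = J i j n} {J i′ j′ n} iso) in sym i′≡i , sym j′≡j

-- Counting Q

Pairs : ℕ → Set
Pairs r = Σ (Fin r) λ b → Fin (toℕ b)

-- The binomial coefficient r choose 2.
triangle : ℕ → ℕ
triangle zero = 0
triangle (suc r) = r + triangle r

Pairs-suc : ∀ r → (Fin r ⊎ Pairs r) ↔ Pairs (suc r)
Pairs-suc r = mk↔ₛ′ to from to∘from from∘to
  where
  to : Fin r ⊎ Pairs r → Pairs (suc r)
  to (inj₁ b) = suc b , zero
  to (inj₂ (b , a)) = suc b , suc a
  from : Pairs (suc r) → Fin r ⊎ Pairs r
  from (suc b , zero) = inj₁ b
  from (suc b , suc a) = inj₂ (b , a)
  to∘from : ∀ p → to (from p) ≡ p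
  to∘from (suc b , zero) = refl
  to∘from (suc b , suc a) = refl
  from∘to : ∀ p → from (to p) ≡ p
  from∘to (inj₁ b) = refl
  from∘to (inj₂ (b , a)) = refl

Fin↔Pairs : ∀ r → Fin (triangle r) ↔ Pairs r
Fin↔Pairs zero = mk↔ₛ′ (λ ()) (λ ()) (λ ()) (λ ())
Fin↔Pairs (suc r) = ↔-trans +↔⊎ (↔-trans (↔-refl ⊎-↔ Fin↔Pairs r) (Pairs-suc r))

-- The two alternatives exclude each other, as (2,3) would give 2 < 2. Hence counting `Q n` is
-- counting the pairs (i,j).
InQ-irrelevant : ∀ {i j} (q q′ : InQ n i j) → q ≡ q′
InQ-irrelevant (inj₁ (a , b , c)) (inj₁ (a′ , b′ , c′)) =
  cong inj₁ (cong₂ _,_ (≤-irrelevant a a′) (cong₂ _,_ (≤-irrelevant b b′) (≤-irrelevant c c′)))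
InQ-irrelevant (inj₁ (_ , s≤s (s≤s ()) , _)) (inj₂ (refl , refl))
InQ-irrelevant (inj₂ (refl , refl)) (inj₁ (_ , s≤s (s≤s ()) , _))
InQ-irrelevant (inj₂ (p , r)) (inj₂ (p′ , r′)) = cong inj₂ (cong₂ _,_ (≡-irrelevant p p′) (≡-irrelevant r r′))

Q-≡ : {q q′ : Q n} → fstQ n q ≡ fstQ n q′ → sndQ n q ≡ sndQ n q′ → q ≡ q′
Q-≡ {n} {i , j , q} {_ , _ , q′} refl refl = cong (λ q → i , j , q) (InQ-irrelevant {n} q q′)

Pairs-≡ : ∀ {r} {(b , a) (b′ , a′) : Pairs r} → toℕ b ≡ toℕ b′ → toℕ a ≡ toℕ a′ → (b , a) ≡ (b′ , a′)
Pairs-≡ b≡ a≡ with refl ← toℕ-injective b≡ = cong (_ ,_) (toℕ-injective a≡)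

-- For n = r + 4, i = a + 2 and j = b + 3, the condition i < j - 1 < n - 2 becomes a < b < r;
-- `Fin 1` accounts for (2,3).
Pairs↔Q : ∀ r → (Fin 1 ⊎ Pairs r) ↔ Q (4 + r)
-- The second inverse law follows from the first and the injectivity of `to`, for which only the
-- numbers i and j are compared.
Pairs↔Q r = mk↔ₛ′ to from to∘from λ p → to-injective (to∘from (to p))
  where
  to : Fin 1 ⊎ Pairs r → Q (4 + r)
  to (inj₁ _) = 2 , 3 , inj₂ (refl , refl)
  to (inj₂ (b , a)) = 2 + toℕ a , 3 + toℕ b ,
    inj₁ (s≤s (s≤s z≤n) , s≤s (s≤s (toℕ<n a)) , s≤s (s≤s (toℕ<n b)))
  from : Q (4 + r) → Fin 1 ⊎ Pairs r
  from (i , j , inj₂ _) = inj₁ zero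
  from (i , suc (suc (suc j)) , inj₁ (s≤s (s≤s z≤n) , s≤s (s≤s i<j) , s≤s (s≤s j<r))) =
    inj₂ (fromℕ< j<r , fromℕ< (subst (_ <_) (sym (toℕ-fromℕ< j<r)) i<j))
  to∘from : ∀ q → to (from q) ≡ q
  to∘from (i , j , inj₂ (refl , refl)) = refl
  to∘from (i , suc (suc (suc j)) , inj₁ (s≤s (s≤s z≤n) , s≤s (s≤s i<j) , s≤s (s≤s j<r))) =
    Q-≡ {4 + r} (cong (2 +_) (toℕ-fromℕ< (subst (_ <_) (sym (toℕ-fromℕ< j<r)) i<j))) (cong (3 +_) (toℕ-fromℕ< j<r))
  unequal : ∀ {b : Fin r} (a : Fin (toℕ b)) → to (inj₁ zero) ≢ to (inj₂ (b , a))
  -- The entry `a` below `b` makes `b` positive, so the second j is at least 4.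
  unequal {suc b} a eq with () ← cong (sndQ (4 + r)) eq
  to-injective : ∀ {p p′} → to p ≡ to p′ → p ≡ p′
  to-injective {inj₁ zero} {inj₁ zero} _ = refl
  to-injective {inj₁ _} {inj₂ (b , a)} eq = ⊥-elim (unequal a eq)
  to-injective {inj₂ (b , a)} {inj₁ _} eq = ⊥-elim (unequal a (sym eq))
  to-injective {inj₂ _} {inj₂ _} eq = cong inj₂ (Pairs-≡
    (+-cancelˡ-≡ 3 _ _ (cong (sndQ (4 + r)) eq)) (+-cancelˡ-≡ 2 _ _ (cong (fstQ (4 + r)) eq)))

triangle-formula : ∀ r → 2 * (1 + triangle r) + 9 * (4 + r) ≡ (4 + r) ^ 2 + 22
triangle-formula zero = refl
triangle-formula (suc r) = begin
  2 * (1 + (r + triangle r)) + 9 * (5 + r)        ≡⟨ shift r (triangle r) ⟩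
  (2 * (1 + triangle r) + 9 * (4 + r)) + (2 * r + 9) ≡⟨ cong (_+ (2 * r + 9)) (triangle-formula r) ⟩
  (4 + r) ^ 2 + 22 + (2 * r + 9)                  ≡⟨ square r ⟩
  (5 + r) ^ 2 + 22                                ∎
  where
  open ≡-Reasoning
  shift : ∀ r t → 2 * (1 + (r + t)) + 9 * (5 + r) ≡ (2 * (1 + t) + 9 * (4 + r)) + (2 * r + 9)
  shift = solve-∀
  -- _^_ is unfolded because the ring solver does not interpret it
  square : ∀ r → (4 + r) * ((4 + r) * 1) + 22 + (2 * r + 9) ≡ (5 + r) * ((5 + r) * 1) + 22
  square = solve-∀

count : ∀ n → 4 ≤ n → Σ ℕ λ m → (2 * m + 9 * n ≡ n ^ 2 + 22) × (Fin m ↔ Q n)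
count (suc (suc (suc (suc r)))) (s≤s (s≤s (s≤s (s≤s z≤n)))) = 1 + triangle r , triangle-formula r ,
  ↔-trans (+↔⊎ {1}) (↔-trans (↔-refl ⊎-↔ Fin↔Pairs r) (Pairs↔Q r))

theorem13p16 : (n : ℕ) → 4 ≤ n →
    (Σ ℕ λ m → (2 * m + 9 * n ≡ n ^ 2 + 22) × (Fin m ↔ Q n))
    × (∀ (q : Q n) → mGU 2 (JQ n q))
    × (∀ (H : Family n) → mGU 2 H → ∃ λ (q : Q n) → Iso H (JQ n q))
    × (∀ (q q' : Q n) → Iso (JQ n q) (JQ n q') → (fstQ n q ≡ fstQ n q') × (sndQ n q ≡ sndQ n q'))
theorem13p16 n 4≤n = count n 4≤n , (λ (_ , _ , q) → InQ⇒mGU 4≤n q) , mGU⇒Iso-J 4≤n , Iso-J⇒≡ 4≤n
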